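{- Let $\Sigma=(G,\sigma)$ be a signed graph with $m$ edges and let $k$ be a positive integer with $$k>\binom{m}{3}+\binom{m}{4}+m-1 .$$ Then $P_l(\Sigma,k)=P(\Sigma,k)$. Further, every $k$-assignment $L$ of $\Sigma$ with $P(\Sigma,L)=P(\Sigma,k)$ satisfies $L(u)=\sigma(e)L(v)$ for each edge $e=uv$ of $\Sigma$. In particular, if $\Sigma$ is unbalanced, then such an $L$ satisfies $L(v)=-L(v)=\{ -a:a\in L(v)\}$ for each vertex $v$ in any unbalanced component of $\Sigma$.
   Context: A signed graph $\Sigma=(G,\sigma)$ is a finite graph $G$ with a sign function $\sigma:E(G)\to\{ -1,1\}$; an edge $e$ is negative if $\sigma(e)=-1$ and positive otherwise. A cycle is unbalanced if it has an odd number of negative edges and balanced otherwise; a signed graph (or a component) is unbalanced if it contains an unbalanced cycle and balanced otherwise. For a positive integer $k$, let $M_k=\{0,\pm1,\ldots,\pm t\}$ if $k=2t+1$ and $M_k=\{\pm1,\ldots,\pm t\}$ if $k=2t$. A proper $k$-coloring of $\Sigma$ is a map $c:V(\Sigma)\to M_k$ with $c(u)\neq\sigma(e)c(v)$ for every edge $e=uv$; $P(\Sigma,k)$ denotes the number of proper $k$-colorings. A list-assignment $L$ assigns to each vertex $v$ a nonempty set $L(v)\subseteq\mathbb{Z}$; it is a $k$-assignment if $|L(v)|=k$ for all $v$. An $L$-coloring is a map $c$ with $c(v)\in L(v)$ for all $v$ and $c(u)\neq\sigma(e)c(v)$ for every edge $e=uv$; $P(\Sigma,L)$ is the number of $L$-colorings.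 For a set $S\subseteq\mathbb{Z}$ and $s\in\{\pm1\}$, $sS=\{sa:a\in S\}$. The list-coloring function is $P_l(\Sigma,k)=\min\{P(\Sigma,L): L \text{ a } k\text{ -assignment of }\Sigma\}$. -}

module Defs where

open import Data.Nat using (ℕ; zero; suc; _≤_; _/_; _%_; _<?_; s≤s)
open import Data.Integer using (ℤ; +_; -[1+_]; +[1+_]; _*_; -_)
open import Data.Fin using (Fin; zero; suc; toℕ; fromℕ<)
open import Data.Fin.Properties using (all?)
open import Data.List using (List; []; _∷_; [_]; map; concatMap; filter; length)
open import Data.List.Membership.Propositional using (_∈_)
open import Data.List.Relation.Unary.Unique.Propositional using (Unique)
open import Data.Vec.Functional as VF using ()
open import Data.Product using (Σ; ∃; ∃-syntax; _×_; _,_)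
open import Data.Sum using (_⊎_)
open import Data.Integer.Properties using () renaming (_≟_ to _≟ℤ_)
open import Relation.Nullary using (¬_; Dec; ¬?; yes; no)
open import Relation.Binary.PropositionalEquality using (_≡_; _≢_)
open import Relation.Binary.Construct.Closure.ReflexiveTransitive using (Star)
open import Function using (_∘_; Injective)

data Sign : Set where
  pos neg : Sign

⟦_⟧ : Sign → ℤ
⟦ pos ⟧ = + 1
⟦ neg ⟧ = -[1+ 0 ]

record SignedGraph (n m : ℕ) : Set where
  field
    end₁ end₂ : Fin m → Fin n
    σ         : Fin m → Sign
    loopless  : ∀ i → end₁ i ≢ end₂ i
    simple    : ∀ i j → ((end₁ i ≡ end₁ j × end₂ i ≡ end₂ j) ⊎
                         (end₁ i ≡ end₂ j × end₂ i ≡ end₁ j)) → i ≡ j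

open SignedGraph public

-- Colour set M_k as a list:
--   M_{2t+1} = {0, ±1, …, ±t},  M_{2t} = {±1, …, ±t}.

M : ℕ → List ℤ
M zero = []
M (suc zero) = + 0 ∷ []
M (suc (suc k)) = +[1+ k / 2 ] ∷ -[1+ k / 2 ] ∷ M k

Proper : ∀ {n m} → SignedGraph n m → (Fin n → ℤ) → Set
Proper Σg c = ∀ i → c (end₁ Σg i) ≢ ⟦ σ Σg i ⟧ * c (end₂ Σg i)

proper? : ∀ {n m} (Σg : SignedGraph n m) (c : Fin n → ℤ) → Dec (Proper Σg c)
proper? Σg c = all? (λ i → ¬? (c (end₁ Σg i) ≟ℤ ⟦ σ Σg i ⟧ * c (end₂ Σg i)))

ListAssignment : ℕ → Set
ListAssignment n = Fin n → List ℤ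

choices : ∀ {n} → ListAssignment n → List (Fin n → ℤ)
choices {zero} L = (λ ()) ∷ []
choices {suc n} L =
  concatMap (λ a → map (λ c → a VF.∷ c) (choices (L ∘ suc))) (L zero)

PL : ∀ {n m} → SignedGraph n m → ListAssignment n → ℕ
PL Σg L = length (filter (proper? Σg) (choices L))

P : ∀ {n m} → SignedGraph n m → ℕ → ℕ
P Σg k = PL Σg (λ _ → M k)

IsKAssignment : ∀ {n} → ListAssignment n → ℕ → Set
IsKAssignment L k = ∀ v → Unique (L v) × length (L v) ≡ k

IsPl : ∀ {n m} → SignedGraph n m → ℕ → ℕ → Set
IsPl Σg k x =
  (∀ L → IsKAssignment L k → x ≤ PL Σg L) ×
  (∃[ L ] (IsKAssignment L k × PL Σg L ≡ x))

_·_ : Sign → List ℤ → List ℤ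
s · S = map (⟦ s ⟧ *_) S

_≈_ : List ℤ → List ℤ → Set
S ≈ T = ∀ a → (a ∈ S → a ∈ T) × (a ∈ T → a ∈ S)

next : ∀ {ℓ} → Fin ℓ → Fin ℓ
next {suc ℓ} i with suc (toℕ i) <? suc ℓ
... | yes p = fromℕ< p
... | no _ = zero

Joins : ∀ {n m} → SignedGraph n m → Fin m → Fin n → Fin n → Set
Joins Σg i u v = (end₁ Σg i ≡ u × end₂ Σg i ≡ v) ⊎ (end₁ Σg i ≡ v × end₂ Σg i ≡ u)

record Cycle {n m} (Σg : SignedGraph n m) : Set where
  field
    ℓ      : ℕ
    ℓ≥3    : 3 ≤ ℓ
    vs     : Fin ℓ → Fin n
    vs-inj : Injective _≡_ _≡_ vs
    es     : Fin ℓ → Fin m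
    joins  : ∀ i → Joins Σg (es i) (vs i) (vs (next i))

open Cycle public

countNeg : ∀ {ℓ m} → (Fin ℓ → Fin m) → (Fin m → Sign) → ℕ
countNeg {zero} es s = 0
countNeg {suc ℓ} es s with s (es zero)
... | pos = countNeg (es ∘ suc) s
... | neg = suc (countNeg (es ∘ suc) s)

UnbalancedCycle : ∀ {n m} {Σg : SignedGraph n m} → Cycle Σg → Set
UnbalancedCycle {Σg = Σg} C = countNeg (es C) (σ Σg) % 2 ≡ 1

Adjacent : ∀ {n m} → SignedGraph n m → Fin n → Fin n → Set
Adjacent Σg u v = ∃[ i ] Joins Σg i u v

Connected : ∀ {n m} → SignedGraph n m → Fin n → Fin n → Set
Connected Σg = Star (Adjacent Σg)

InUnbalancedComponent : ∀ {n m} → SignedGraph n m → Fin n → Set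
InUnbalancedComponent Σg v =
  ∃[ C ] (UnbalancedCycle {Σg = Σg} C × ∃[ j ] Connected Σg v (vs C j))

Unbalanced : ∀ {n m} → SignedGraph n m → Set
Unbalanced Σg = ∃[ C ] UnbalancedCycle {Σg = Σg} C

-- Order the edges, and write f(S) for the number of colourings violating every edge of S. Adding an
-- edge e to the earlier edges destroys N(e) colourings, namely those violating e and no earlier edge.
-- Discard an earlier edge j when a still earlier edge closes a balanced triangle with j and e; a
-- colouring violating e and some earlier edge violates one that is not discarded. Hence
--   f(e) - Σ_j f(ej)  ≤  N(e)  ≤  f(e) - Σ_j f(ej) + Σ_{j,j'} f(ejj'),
-- the sums being over edges not discarded, so that no {e,j,j'} is a balanced triangle and
-- k³ f(ejj') ≤ kⁿ. Let β(e) = kⁿ - k f(e) for the given lists; it vanishes for the lists M k, and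
-- k β(e) ≥ kⁿ as soon as L(u) ≠ σ(e) L(v). As k² f(ej) ≥ kⁿ - β(e) - β(j), comparing the lower bound
-- for M k with the upper bound for L and summing over e yields, with B = Σ β(e),
--   k³ (P(Σ,L) - P(Σ,k))  ≥  k (k + 1 - m) B - C(m,3) kⁿ,
-- which is positive if some edge has L(u) ≠ σ(e) L(v).
-- If all edges have L(u) = σ(e) L(v), the order-preserving bijections L(v) → M k commute with negation
-- (which reverses the order of both sides), so they turn L-colourings into k-colourings.

module Submission where

open import Defs
open import Data.Nat using (ℕ; zero; suc; _+_; _*_; _∸_; _^_; _<_; _≤_; _<?_; z≤n; s≤s; _/_; _%_)
open import Data.Nat.Properties
open import Data.Nat.Combinatorics using (_C_; nC1≡n; nCk+nC[k+1]≡[n+1]C[k+1])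
open import Data.Nat.ListAction using (sum)
open import Data.Nat.ListAction.Properties using (sum-++; sum-↭)
open import Data.Nat.Tactic.RingSolver using (solve-∀)
open import Data.Integer as ℤ using (ℤ; -[1+_]; +[1+_])
import Data.Integer.Properties as ℤP
open import Data.Fin using (Fin; zero; suc; inject₁; fromℕ; toℕ)
import Data.Fin.Properties as FinP
open import Data.List using (List; []; _∷_; _++_; map; concatMap; filter; length; allFin)
open import Data.List.Properties using (length-map; length-tabulate; map-++; map-∘)
open import Data.List.Membership.Propositional using (_∈_; _∉_; find; lose)
open import Data.List.Membership.Propositional.Properties
  using (∈-map⁺; ∈-map⁻; ∈-∃++; ∈-allFin; ∈-concatMap⁻)
open import Data.List.Relation.Unary.Any using (here; there; any?)
open import Data.List.Relation.Unary.All as All using (All; []; _∷_)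
open import Data.List.Relation.Unary.AllPairs using ([]; _∷_)
open import Data.List.Relation.Unary.Unique.Propositional using (Unique)
import Data.List.Relation.Unary.Unique.Propositional.Properties as UniqueP
open import Data.List.Relation.Binary.Permutation.Propositional as Perm using (_↭_)
import Data.List.Relation.Binary.Permutation.Propositional.Properties as PermP
open import Data.List.Relation.Binary.Subset.Propositional using (_⊆_)
open import Data.Vec.Functional as VF using (updateAt)
open import Data.Vec.Functional.Properties using (updateAt-updates; updateAt-minimal)
open import Data.Product using (∃-syntax; ∃₂; _×_; _,_; proj₁; proj₂)
open import Data.Sum using (_⊎_; inj₁; inj₂; [_,_]′)
open import Data.Empty using (⊥-elim)
open import Relation.Nullary using (¬_; Dec; yes; no; ¬?; _×-dec_; _⊎-dec_)
open import Relation.Binary.PropositionalEquality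
  using (_≡_; _≢_; refl; sym; trans; cong; cong₂; subst; module ≡-Reasoning)
open import Relation.Binary.Construct.Closure.ReflexiveTransitive using (ε; _◅_)
open import Function using (_∘_; const; case_of_)
import Data.List.Relation.Unary.All.Properties as AllP
open import Data.List.Membership.DecPropositional ℤ._≟_ using (_∈?_)
open import Data.Nat.DivMod using (m/n≡1+[m∸n]/n)
open import Data.Fin.Induction using (<-weakInduction)
open import Relation.Binary.Definitions using (tri<; tri≈; tri>)

-- Finite sums and indicators

∑ : {A : Set} → List A → (A → ℕ) → ℕ
∑ xs f = sum (map f xs)

module _ {A : Set} where

  ∑-mono-∈ : (xs : List A) {f g : A → ℕ} → (∀ {x} → x ∈ xs → f x ≤ g x) → ∑ xs f ≤ ∑ xs g
  ∑-mono-∈ []       h = z≤n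
  ∑-mono-∈ (x ∷ xs) h = +-mono-≤ (h (here refl)) (∑-mono-∈ xs (h ∘ there))

  ∑-mono : (xs : List A) {f g : A → ℕ} → (∀ x → f x ≤ g x) → ∑ xs f ≤ ∑ xs g
  ∑-mono xs h = ∑-mono-∈ xs (λ {x} _ → h x)

  ∑-cong : (xs : List A) {f g : A → ℕ} → (∀ x → f x ≡ g x) → ∑ xs f ≡ ∑ xs g
  ∑-cong []       h = refl
  ∑-cong (x ∷ xs) h = cong₂ _+_ (h x) (∑-cong xs h)

  ∑-+ : (xs : List A) (f g : A → ℕ) → ∑ xs (λ x → f x + g x) ≡ ∑ xs f + ∑ xs g
  ∑-+ []       f g = refl
  ∑-+ (x ∷ xs) f g rewrite ∑-+ xs f g = lemma (f x) (g x) (∑ xs f) (∑ xs g)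
    where
    lemma : ∀ a b c d → (a + b) + (c + d) ≡ (a + c) + (b + d)
    lemma = solve-∀

  ∑-*ˡ : (xs : List A) (k : ℕ) (f : A → ℕ) → ∑ xs (λ x → k * f x) ≡ k * ∑ xs f
  ∑-*ˡ []       k f = sym (*-zeroʳ k)
  ∑-*ˡ (x ∷ xs) k f rewrite ∑-*ˡ xs k f = sym (*-distribˡ-+ k (f x) (∑ xs f))

  ∑-const : (xs : List A) (k : ℕ) → ∑ xs (λ _ → k) ≡ length xs * k
  ∑-const []       k = refl
  ∑-const (x ∷ xs) k = cong (k +_) (∑-const xs k)

  ∑-++ : (xs ys : List A) (f : A → ℕ) → ∑ (xs ++ ys) f ≡ ∑ xs f + ∑ ys f
  ∑-++ xs ys f rewrite map-++ f xs ys = sum-++ (map f xs) (map f ys)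

  ∑-↭ : {xs ys : List A} (f : A → ℕ) → xs ↭ ys → ∑ xs f ≡ ∑ ys f
  ∑-↭ f p = sum-↭ (PermP.map⁺ f p)

  member≤∑ : {xs : List A} (f : A → ℕ) {x : A} → x ∈ xs → f x ≤ ∑ xs f
  member≤∑ f (here refl) = m≤m+n _ _
  member≤∑ f (there p)   = ≤-trans (member≤∑ f p) (m≤n+m _ _)

module _ {A B : Set} where

  ∑-map : (g : A → B) (xs : List A) (f : B → ℕ) → ∑ (map g xs) f ≡ ∑ xs (f ∘ g)
  ∑-map g xs f = cong sum (sym (map-∘ xs))

  ∑-concatMap : (g : A → List B) (xs : List A) (f : B → ℕ) →
    ∑ (concatMap g xs) f ≡ ∑ xs (λ x → ∑ (g x) f)
  ∑-concatMap g []       f = refl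
  ∑-concatMap g (x ∷ xs) f =
    trans (∑-++ (g x) (concatMap g xs) f) (cong (∑ (g x) f +_) (∑-concatMap g xs f))

  ∑-swap : (xs : List A) (ys : List B) (f : A → B → ℕ) →
    ∑ xs (λ x → ∑ ys (f x)) ≡ ∑ ys (λ y → ∑ xs (λ x → f x y))
  ∑-swap []       ys f = sym (trans (∑-const ys 0) (*-zeroʳ (length ys)))
  ∑-swap (x ∷ xs) ys f rewrite ∑-swap xs ys f = sym (∑-+ ys (f x) _)

-- Each unordered pair of positions is counted once, with the entry nearer the head as the first
-- argument of `g`; `pairs-relevant` depends on that order.
pairs : {A : Set} → (A → A → ℕ) → List A → ℕ
pairs g []       = 0
pairs g (x ∷ xs) = ∑ xs (g x) + pairs g xs

pairs-*ˡ : {A : Set} (k : ℕ) (g : A → A → ℕ) (xs : List A) →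
  pairs (λ x y → k * g x y) xs ≡ k * pairs g xs
pairs-*ˡ k g []       = sym (*-zeroʳ k)
pairs-*ˡ k g (x ∷ xs) rewrite ∑-*ˡ xs k (g x) | pairs-*ˡ k g xs =
  sym (*-distribˡ-+ k (∑ xs (g x)) (pairs g xs))

∑-pairs : {A B : Set} (cs : List B) (g : B → A → A → ℕ) (xs : List A) →
  ∑ cs (λ c → pairs (g c) xs) ≡ pairs (λ x y → ∑ cs (λ c → g c x y)) xs
∑-pairs cs g []       = trans (∑-const cs 0) (*-zeroʳ (length cs))
∑-pairs cs g (x ∷ xs) =
  trans (∑-+ cs (λ c → ∑ xs (g c x)) _)
        (cong₂ _+_ (∑-swap cs xs (λ c → g c x)) (∑-pairs cs g xs))

pairs-const : {A : Set} (xs : List A) (k : ℕ) → pairs (λ _ _ → k) xs ≡ (length xs C 2) * k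
pairs-const []       k = refl
pairs-const (x ∷ xs) k = begin
  ∑ xs (λ _ → k) + pairs (λ _ _ → k) xs   ≡⟨ cong₂ _+_ (∑-const xs k) (pairs-const xs k) ⟩
  l * k + (l C 2) * k                     ≡⟨ sym (*-distribʳ-+ k l (l C 2)) ⟩
  (l + (l C 2)) * k                       ≡⟨ cong (λ z → (z + (l C 2)) * k) (sym (nC1≡n l)) ⟩
  ((l C 1) + (l C 2)) * k                 ≡⟨ cong (_* k) (nCk+nC[k+1]≡[n+1]C[k+1] l 1) ⟩
  (suc l C 2) * k                         ∎
  where
  open ≡-Reasoning
  l = length xs

𝟙 : {Q : Set} → Dec Q → ℕ
𝟙 (yes _) = 1
𝟙 (no _)  = 0

module _ {Q : Set} where

  𝟙-true : (d : Dec Q) → Q → 𝟙 d ≡ 1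
  𝟙-true (yes _) q = refl
  𝟙-true (no ¬q) q = ⊥-elim (¬q q)

  𝟙-false : (d : Dec Q) → ¬ Q → 𝟙 d ≡ 0
  𝟙-false (yes q) ¬q = ⊥-elim (¬q q)
  𝟙-false (no _)  _  = refl

𝟙-mono : {Q R : Set} (d : Dec Q) (e : Dec R) → (Q → R) → 𝟙 d ≤ 𝟙 e
𝟙-mono (yes q) e f = ≤-reflexive (sym (𝟙-true e (f q)))
𝟙-mono (no _)  e f = z≤n

𝟙-cong : {Q R : Set} (d : Dec Q) (e : Dec R) → (Q → R) → (R → Q) → 𝟙 d ≡ 𝟙 e
𝟙-cong d e f g = ≤-antisym (𝟙-mono d e f) (𝟙-mono e d g)

length-filter≡∑ : {A : Set} {Q : A → Set} (Q? : ∀ x → Dec (Q x)) (xs : List A) →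
  length (filter Q? xs) ≡ ∑ xs (λ x → 𝟙 (Q? x))
length-filter≡∑ Q? [] = refl
length-filter≡∑ Q? (x ∷ xs) with Q? x
... | yes _ = cong suc (length-filter≡∑ Q? xs)
... | no _  = length-filter≡∑ Q? xs

-- Lists without repetition

-- Pigeonhole: deleting the head `x` from `ys` leaves a list that still contains the tail and is no
-- longer than it, so induction applies.
unique-⊆⇒↭ : {A : Set} {xs ys : List A} → Unique xs → xs ⊆ ys → length ys ≤ length xs → xs ↭ ys
unique-⊆⇒↭ {xs = []} {[]} _ _ _ = Perm.refl
unique-⊆⇒↭ {xs = x ∷ xs} {ys} (x∉xs ∷ uxs) sub len
  with as , bs , refl ← ∈-∃++ (sub (here refl)) =
    Perm.trans (Perm.prep x (unique-⊆⇒↭ uxs sub′ len′)) (Perm.↭-sym (PermP.shift x as bs))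
  where
  sub′ : xs ⊆ as ++ bs
  sub′ y∈xs with PermP.∈-resp-↭ (PermP.shift x as bs) (sub (there y∈xs))
  ... | here refl = ⊥-elim (All.lookup x∉xs y∈xs refl)
  ... | there p   = p
  len′ : length (as ++ bs) ≤ length xs
  len′ = ≤-pred (subst (_≤ suc (length xs)) (PermP.↭-length (PermP.shift x as bs)) len)

-- On a repetition-free list this is the 0/1 indicator of membership. Written as a sum over the
-- list, it is exactly what summing over the colours of one vertex produces.
mult : List ℤ → ℤ → ℕ
mult S b = ∑ S (λ a → 𝟙 (a ℤ.≟ b))

∉⇒mult≡0 : (S : List ℤ) {b : ℤ} → b ∉ S → mult S b ≡ 0
∉⇒mult≡0 []      b∉S = refl
∉⇒mult≡0 (a ∷ S) {b} b∉S rewrite 𝟙-false (a ℤ.≟ b) (λ { refl → b∉S (here refl) }) =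
  ∉⇒mult≡0 S (b∉S ∘ there)

∈⇒1≤mult : {S : List ℤ} {b : ℤ} → b ∈ S → 1 ≤ mult S b
∈⇒1≤mult {S} {b} b∈S =
  subst (_≤ mult S b) (𝟙-true (b ℤ.≟ b) refl) (member≤∑ (λ a → 𝟙 (a ℤ.≟ b)) b∈S)

mult≤1 : {S : List ℤ} (b : ℤ) → Unique S → mult S b ≤ 1
mult≤1 {[]}    b _ = z≤n
mult≤1 {a ∷ S} b (a∉S ∷ uS) with a ℤ.≟ b
... | yes refl rewrite ∉⇒mult≡0 S (λ a∈S → All.lookup a∉S a∈S refl) = ≤-refl
... | no _     = mult≤1 b uS

-- Colourings from lists, and resampling the colour of one vertex

Colouring : ℕ → Set
Colouring n = Fin n → ℤ

-- Colourings are functions and the ones compared below agree only pointwise, so invariance under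
-- pointwise equality is assumed in place of function extensionality.
Ext : ∀ {n} → (Colouring n → ℕ) → Set
Ext F = ∀ c c′ → (∀ v → c v ≡ c′ v) → F c ≡ F c′

Indep : ∀ {n} {A : Set} → Fin n → (Colouring n → A) → Set
Indep u F = ∀ c c′ → (∀ v → v ≢ u → c v ≡ c′ v) → F c ≡ F c′

Indep⇒Ext : ∀ {n} {u : Fin n} {A : Set} {F : Colouring n → A} →
  Indep u F → ∀ c c′ → (∀ v → c v ≡ c′ v) → F c ≡ F c′
Indep⇒Ext i c c′ h = i c c′ (λ v _ → h v)

∑-choices : ∀ {n} (L : ListAssignment (suc n)) (F : Colouring (suc n) → ℕ) →
  ∑ (choices L) F ≡ ∑ (L zero) (λ a → ∑ (choices (L ∘ suc)) (λ c → F (a VF.∷ c)))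
∑-choices L F =
  trans (∑-concatMap _ (L zero) F) (∑-cong (L zero) (λ a → ∑-map (a VF.∷_) (choices (L ∘ suc)) F))

∈-choices : ∀ {n} (L : ListAssignment n) {c} → c ∈ choices L → ∀ v → c v ∈ L v
∈-choices {suc n} L c∈ v
  with a , a∈ , c∈′ ← find (∈-concatMap⁻ (λ a → map (a VF.∷_) (choices (L ∘ suc))) {xs = L zero} c∈)
  with c′ , c′∈ , refl ← ∈-map⁻ (a VF.∷_) c∈′
  with v
... | zero  = a∈
... | suc w = ∈-choices (L ∘ suc) c′∈ w

cons-cong : ∀ {n} {a : ℤ} {c c′ : Colouring n} → (∀ v → c v ≡ c′ v) → ∀ v → (a VF.∷ c) v ≡ (a VF.∷ c′) v
cons-cong h zero    = refl
cons-cong h (suc v) = h v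

-- Recolouring `u` uniformly from `L u` preserves the uniform distribution on colourings. The factor
-- `length (L u)` replaces the average by a sum and keeps the identity in ℕ.
resample : ∀ {n} (L : ListAssignment n) (u : Fin n) (F : Colouring n → ℕ) → Ext F →
  length (L u) * ∑ (choices L) F ≡
  ∑ (choices L) (λ c → ∑ (L u) (λ a → F (updateAt c u (const a))))
resample {suc n} L zero F ext = begin
  l * ∑ (choices L) F                                  ≡⟨ cong (l *_) (∑-choices L F) ⟩
  l * ∑ (L zero) (λ a → ∑ Cs (λ c → F (a VF.∷ c)))     ≡⟨ cong (l *_) (∑-swap (L zero) Cs _) ⟩
  -- Nothing here reads an old colour of `zero` any more, so the factor `l` can be spent as a sum
  -- over that colour, `b`.
  l * ∑ Cs (λ c → ∑ (L zero) (λ a → F (a VF.∷ c)))     ≡⟨ sym (∑-const (L zero) _) ⟩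
  ∑ (L zero) (λ _ → ∑ Cs (λ c → ∑ (L zero) (λ a → F (a VF.∷ c))))
    ≡⟨ ∑-cong (L zero) (λ b → ∑-cong Cs (λ c → ∑-cong (L zero) (λ a → ext _ _ (same b c a)))) ⟩
  ∑ (L zero) (λ b → ∑ Cs (λ c → ∑ (L zero) (λ a → F (updateAt (b VF.∷ c) zero (const a)))))
    ≡⟨ sym (∑-choices L _) ⟩
  ∑ (choices L) (λ c → ∑ (L zero) (λ a → F (updateAt c zero (const a)))) ∎
  where
  open ≡-Reasoning
  l  = length (L zero)
  Cs = choices (L ∘ suc)
  same : ∀ b c a v → (a VF.∷ c) v ≡ updateAt (b VF.∷ c) zero (const a) v
  same b c a zero    = refl
  same b c a (suc v) = refl
resample {suc n} L (suc u) F ext = begin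
  l * ∑ (choices L) F                                         ≡⟨ cong (l *_) (∑-choices L F) ⟩
  l * ∑ (L zero) (λ b → ∑ Cs (λ c → F (b VF.∷ c)))            ≡⟨ sym (∑-*ˡ (L zero) l _) ⟩
  ∑ (L zero) (λ b → l * ∑ Cs (λ c → F (b VF.∷ c)))
    ≡⟨ ∑-cong (L zero) (λ b → resample (L ∘ suc) u (λ c → F (b VF.∷ c))
                                (λ c c′ h → ext _ _ (cons-cong h))) ⟩
  ∑ (L zero) (λ b → ∑ Cs (λ c → ∑ (L (suc u)) (λ a → F (b VF.∷ updateAt c u (const a)))))
    ≡⟨ ∑-cong (L zero) (λ b → ∑-cong Cs (λ c → ∑-cong (L (suc u)) (λ a → ext _ _ (same b c a)))) ⟩
  ∑ (L zero) (λ b → ∑ Cs (λ c → ∑ (L (suc u)) (λ a → F (updateAt (b VF.∷ c) (suc u) (const a)))))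
    ≡⟨ sym (∑-choices L _) ⟩
  ∑ (choices L) (λ c → ∑ (L (suc u)) (λ a → F (updateAt c (suc u) (const a)))) ∎
  where
  open ≡-Reasoning
  l  = length (L (suc u))
  Cs = choices (L ∘ suc)
  same : ∀ b c a v → (b VF.∷ updateAt c u (const a)) v ≡ updateAt (b VF.∷ c) (suc u) (const a) v
  same b c a zero    = refl
  same b c a (suc v) = refl

∑-choices-1 : ∀ {n k} (L : ListAssignment n) → (∀ v → length (L v) ≡ k) → ∑ (choices L) (λ _ → 1) ≡ k ^ n
∑-choices-1 {zero}  L len = refl
∑-choices-1 {suc n} {k} L len = begin
  ∑ (choices L) (λ _ → 1)                             ≡⟨ ∑-choices L _ ⟩
  ∑ (L zero) (λ _ → ∑ (choices (L ∘ suc)) (λ _ → 1))  ≡⟨ ∑-const (L zero) _ ⟩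
  length (L zero) * ∑ (choices (L ∘ suc)) (λ _ → 1)   ≡⟨ cong₂ _*_ (len zero) (∑-choices-1 (L ∘ suc) (len ∘ suc)) ⟩
  k * k ^ n                                           ∎
  where open ≡-Reasoning

-- Change of variables: a bijection `g v` from `L′ v` to `L v` at each vertex carries the colourings
-- from `L′` onto those from `L`.
∑-choices-↭ : ∀ {n} (L L′ : ListAssignment n) (g : Fin n → ℤ → ℤ) → (∀ v → map (g v) (L′ v) ↭ L v) →
  (F : Colouring n → ℕ) → Ext F →
  ∑ (choices L) F ≡ ∑ (choices L′) (λ c → F (λ v → g v (c v)))
∑-choices-↭ {zero}  L L′ g p F ext = cong (_+ 0) (ext _ _ λ ())
∑-choices-↭ {suc n} L L′ g p F ext = begin
  ∑ (choices L) F                                           ≡⟨ ∑-choices L F ⟩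
  ∑ (L zero) (λ a → ∑ (choices (L ∘ suc)) (λ c → F (a VF.∷ c)))
    ≡⟨ sym (∑-↭ _ (p zero)) ⟩
  ∑ (map (g zero) (L′ zero)) (λ a → ∑ (choices (L ∘ suc)) (λ c → F (a VF.∷ c)))
    ≡⟨ ∑-map (g zero) (L′ zero) _ ⟩
  ∑ (L′ zero) (λ a → ∑ (choices (L ∘ suc)) (λ c → F (g zero a VF.∷ c)))
    ≡⟨ ∑-cong (L′ zero) (λ a → ∑-choices-↭ (L ∘ suc) (L′ ∘ suc) (g ∘ suc) (p ∘ suc) _
                                  (λ c c′ h → ext _ _ (cons-cong h))) ⟩
  ∑ (L′ zero) (λ a → ∑ (choices (L′ ∘ suc)) (λ c → F (g zero a VF.∷ (λ v → g (suc v) (c v)))))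
    ≡⟨ ∑-cong (L′ zero) (λ a → ∑-cong (choices (L′ ∘ suc)) (λ c → ext _ _ (same a c))) ⟩
  ∑ (L′ zero) (λ a → ∑ (choices (L′ ∘ suc)) (λ c → F (λ v → g v ((a VF.∷ c) v))))
    ≡⟨ sym (∑-choices L′ _) ⟩
  ∑ (choices L′) (λ c → F (λ v → g v (c v)))                ∎
  where
  open ≡-Reasoning
  same : ∀ a c v → (g zero a VF.∷ (λ w → g (suc w) (c w))) v ≡ g v ((a VF.∷ c) v)
  same a c zero    = refl
  same a c (suc v) = refl

-- Signed graphs

⟦⟧-invol : ∀ s (a : ℤ) → ⟦ s ⟧ ℤ.* (⟦ s ⟧ ℤ.* a) ≡ a
⟦⟧-invol pos a = trans (ℤP.*-identityˡ _) (ℤP.*-identityˡ a)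
⟦⟧-invol neg a = trans (ℤP.-1*i≡-i (⟦ neg ⟧ ℤ.* a)) (trans (cong ℤ.-_ (ℤP.-1*i≡-i a)) (ℤP.neg-involutive a))

_⊗_ : Sign → Sign → Sign
pos ⊗ t   = t
neg ⊗ pos = neg
neg ⊗ neg = pos

⟦⟧-⊗ : ∀ s t (a : ℤ) → ⟦ s ⊗ t ⟧ ℤ.* a ≡ ⟦ s ⟧ ℤ.* (⟦ t ⟧ ℤ.* a)
⟦⟧-⊗ pos t   a = sym (ℤP.*-identityˡ _)
⟦⟧-⊗ neg pos a = cong (⟦ neg ⟧ ℤ.*_) (sym (ℤP.*-identityˡ a))
⟦⟧-⊗ neg neg a = trans (ℤP.*-identityˡ a) (sym (⟦⟧-invol neg a))

≡neg⇒≡0 : ∀ (a : ℤ) → a ≡ ⟦ neg ⟧ ℤ.* a → a ≡ ℤ.0ℤ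
≡neg⇒≡0 (ℤ.+ zero)  _ = refl
≡neg⇒≡0 (+[1+ _ ]) ()
≡neg⇒≡0 (-[1+ _ ]) ()

⟦⟧*≡⇒≡0 : ∀ s (a : ℤ) → ⟦ s ⟧ ℤ.* a ≡ ℤ.0ℤ → a ≡ ℤ.0ℤ
⟦⟧*≡⇒≡0 s a eq = trans (sym (⟦⟧-invol s a)) (trans (cong (⟦ s ⟧ ℤ.*_) eq) (ℤP.*-zeroʳ ⟦ s ⟧))

_≟ˢ_ : (s t : Sign) → Dec (s ≡ t)
pos ≟ˢ pos = yes refl
pos ≟ˢ neg = no λ ()
neg ≟ˢ pos = no λ ()
neg ≟ˢ neg = yes refl

≢⊗ : ∀ s t r → s ≢ t ⊗ r → s ≡ neg ⊗ (t ⊗ r)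
≢⊗ pos pos pos h = ⊥-elim (h refl)
≢⊗ pos pos neg h = refl
≢⊗ pos neg pos h = refl
≢⊗ pos neg neg h = ⊥-elim (h refl)
≢⊗ neg pos pos h = refl
≢⊗ neg pos neg h = ⊥-elim (h refl)
≢⊗ neg neg pos h = ⊥-elim (h refl)
≢⊗ neg neg neg h = refl

module Graph {n m : ℕ} (G : SignedGraph n m) where

  Violates : Fin m → Colouring n → Set
  Violates i c = c (end₁ G i) ≡ ⟦ σ G i ⟧ ℤ.* c (end₂ G i)

  violates? : ∀ i c → Dec (Violates i c)
  violates? i c = c (end₁ G i) ℤ.≟ ⟦ σ G i ⟧ ℤ.* c (end₂ G i)

  x : Fin m → Colouring n → ℕ
  x i c = 𝟙 (violates? i c)

  joins-sym : ∀ {i u v} → Joins G i u v → Joins G i v u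
  joins-sym (inj₁ p) = inj₂ p
  joins-sym (inj₂ p) = inj₁ p

  joins-≢ : ∀ {i u v} → Joins G i u v → u ≢ v
  joins-≢ {i} (inj₁ (refl , refl)) = loopless G i
  joins-≢ {i} (inj₂ (refl , refl)) = loopless G i ∘ sym

  joins-unique : ∀ {i j u v} → Joins G i u v → Joins G j u v → i ≡ j
  joins-unique {i} {j} (inj₁ (refl , refl)) (inj₁ (p , q)) = simple G i j (inj₁ (sym p , sym q))
  joins-unique {i} {j} (inj₁ (refl , refl)) (inj₂ (p , q)) = simple G i j (inj₂ (sym q , sym p))
  joins-unique {i} {j} (inj₂ (refl , refl)) (inj₁ (p , q)) = simple G i j (inj₂ (sym q , sym p))
  joins-unique {i} {j} (inj₂ (refl , refl)) (inj₂ (p , q)) = simple G i j (inj₁ (sym p , sym q))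

  joins? : ∀ i u v → Dec (Joins G i u v)
  joins? i u v = ((end₁ G i FinP.≟ u) ×-dec (end₂ G i FinP.≟ v))
           ⊎-dec ((end₁ G i FinP.≟ v) ×-dec (end₂ G i FinP.≟ u))

  violates⇒ : ∀ {i u v c} → Joins G i u v → Violates i c → c u ≡ ⟦ σ G i ⟧ ℤ.* c v
  violates⇒ (inj₁ (refl , refl)) p = p
  violates⇒ {i} {c = c} (inj₂ (refl , refl)) p =
    sym (trans (cong (⟦ σ G i ⟧ ℤ.*_) p) (⟦⟧-invol (σ G i) _))

  ⇒violates : ∀ {i u v c} → Joins G i u v → c u ≡ ⟦ σ G i ⟧ ℤ.* c v → Violates i c
  ⇒violates (inj₁ (refl , refl)) p = p
  ⇒violates {i} {c = c} (inj₂ (refl , refl)) p =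
    sym (trans (cong (⟦ σ G i ⟧ ℤ.*_) p) (⟦⟧-invol (σ G i) _))

  x-joins : ∀ {i u v} → Joins G i u v → ∀ c → x i c ≡ 𝟙 (c u ℤ.≟ ⟦ σ G i ⟧ ℤ.* c v)
  x-joins {i} {u} {v} J c =
    𝟙-cong (violates? i c) (c u ℤ.≟ ⟦ σ G i ⟧ ℤ.* c v) (violates⇒ {c = c} J) (⇒violates {c = c} J)

  Off : Fin m → Fin n → Set
  Off i u = end₁ G i ≢ u × end₂ G i ≢ u

  On : Fin m → Fin n → Set
  On i u = ∃[ w ] Joins G i u w

  on? : ∀ i u → On i u ⊎ Off i u
  on? i u with end₁ G i FinP.≟ u | end₂ G i FinP.≟ u
  ... | yes p | _     = inj₁ (end₂ G i , inj₁ (p , refl))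
  ... | no _  | yes q = inj₁ (end₁ G i , inj₂ (refl , q))
  ... | no p  | no q  = inj₂ (p , q)

  x-indep : ∀ {i u} → Off i u → Indep u (x i)
  x-indep (p , q) c c′ h rewrite h _ p | h _ q = refl

  joins-cover : ∀ {i a b u} → Joins G i a b → On i u → (u ≡ a) ⊎ (u ≡ b)
  joins-cover (inj₁ (refl , refl)) (w , inj₁ (refl , _)) = inj₁ refl
  joins-cover (inj₁ (refl , refl)) (w , inj₂ (_ , refl)) = inj₂ refl
  joins-cover (inj₂ (refl , refl)) (w , inj₁ (refl , _)) = inj₂ refl
  joins-cover (inj₂ (refl , refl)) (w , inj₂ (_ , refl)) = inj₁ refl

  joins-off : ∀ {i a b u} → Joins G i a b → u ≢ a → u ≢ b → Off i u
  joins-off {i} {u = u} J p q with on? i u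
  ... | inj₂ off = off
  ... | inj₁ on  = ⊥-elim ([ p , q ]′ (joins-cover J on))

  on-both : ∀ {i a b} → a ≢ b → On i a → On i b → Joins G i a b
  on-both a≢b (w , J) (_ , K) with joins-cover J (_ , K)
  ... | inj₁ b≡a = ⊥-elim (a≢b (sym b≡a))
  ... | inj₂ refl = J

  -- In a simple graph distinct edges cannot share both ends. The end found here can be recoloured
  -- without affecting whether `j` is violated.
  private-end : ∀ {i j} → i ≢ j → ∃₂ λ u v → Joins G i u v × Off j u
  private-end {i} {j} i≢j with on? j (end₁ G i) | on? j (end₂ G i)
  ... | inj₂ off | _        = _ , _ , inj₁ (refl , refl) , off
  ... | inj₁ _   | inj₂ off = _ , _ , inj₂ (refl , refl) , off
  ... | inj₁ p   | inj₁ q   =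
    ⊥-elim (i≢j (joins-unique (inj₁ (refl , refl)) (on-both (loopless G i) p q)))

  other-end : ∀ j v → ∃₂ λ w y → Joins G j w y × w ≢ v
  other-end j v with end₁ G j FinP.≟ v
  ... | no p     = _ , _ , inj₁ (refl , refl) , p
  ... | yes refl = _ , _ , inj₂ (refl , refl) , (loopless G j ∘ sym)

  -- Triangles and triples of edges

  Triangle : Fin m → Fin m → Fin m → Set
  Triangle h j e = ∃[ a ] ∃[ b ] ∃[ c ] (Joins G h a b × Joins G j b c × Joins G e a c)

  Balanced△ : Fin m → Fin m → Fin m → Set
  Balanced△ h j e = Triangle h j e × σ G e ≡ σ G h ⊗ σ G j

  balanced△? : ∀ h j e → Dec (Balanced△ h j e)
  balanced△? h j e =
    FinP.any? (λ a → FinP.any? (λ b → FinP.any? (λ c →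
      joins? h a b ×-dec (joins? j b c ×-dec joins? e a c))))
    ×-dec (σ G e ≟ˢ (σ G h ⊗ σ G j))

  -- This is what justifies discarding `j`: a colouring that violates `j` and `e` is already caught
  -- by the earlier edge `h`.
  balanced△-violates : ∀ {h j e c} → Balanced△ h j e → Violates j c → Violates e c → Violates h c
  balanced△-violates {h} {j} {e} {c} ((u , v , w , H , J , E) , sg) vj ve = ⇒violates {c = c} H (begin
    c u                                          ≡⟨ violates⇒ {c = c} E ve ⟩
    ⟦ σ G e ⟧ ℤ.* c w                            ≡⟨ cong (λ s → ⟦ s ⟧ ℤ.* c w) sg ⟩
    ⟦ σ G h ⊗ σ G j ⟧ ℤ.* c w                    ≡⟨ ⟦⟧-⊗ (σ G h) (σ G j) (c w) ⟩
    ⟦ σ G h ⟧ ℤ.* (⟦ σ G j ⟧ ℤ.* c w)            ≡⟨ cong (⟦ σ G h ⟧ ℤ.*_) (sym (violates⇒ {c = c} J vj)) ⟩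
    ⟦ σ G h ⟧ ℤ.* c v                            ∎)
    where open ≡-Reasoning

  data Shape (h j e : Fin m) : Set where
    leaf₁    : ∀ {u v} → Joins G h u v → Off j u → Off e u → Shape h j e
    leaf₃    : ∀ {u v} → Joins G e u v → Off h u → Off j u → Shape h j e
    triangle : Triangle h j e → Shape h j e

  -- Three distinct edges of a simple graph form a triangle or a forest. A forest with three edges
  -- has at least two edges ending in a leaf, so one of `h` and `e` does, and no case for `j`
  -- arises.
  shape : ∀ {h j e} → h ≢ j → h ≢ e → j ≢ e → Shape h j e
  shape {h} {j} {e} h≢j h≢e j≢e = cases (on? e a) (on? j a) (on? e b) (on? j b)
    where
    a = end₁ G h
    b = end₂ G h
    Hab : Joins G h a b
    Hab = inj₁ (refl , refl)

    -- Here `e` meets `h` at `a` and `j` meets `h` at `b`. Either the far end of `e` misses `j`, and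
    -- is then private to `e`, or it is the far end of `j` and the three edges close up.
    close : ∀ {a b} → Joins G h a b → On e a → On j b → Shape h j e
    close {a} {b} H (c , E) (d , J) with on? j c
    ... | inj₂ offj = leaf₃ (joins-sym E) (joins-off H (joins-≢ E ∘ sym) c≢b) offj
      where
      c≢b : c ≢ b
      c≢b refl = h≢e (joins-unique H E)
    ... | inj₁ on with joins-cover J on
    ... | inj₁ refl = ⊥-elim (h≢e (joins-unique H E))
    ... | inj₂ refl = triangle (_ , _ , _ , H , J , E)

    cases : On e a ⊎ Off e a → On j a ⊎ Off j a → On e b ⊎ Off e b → On j b ⊎ Off j b → Shape h j e
    cases (inj₁ ea) _ _ (inj₁ jb) = close Hab ea jb
    cases _ (inj₁ ja) (inj₁ eb) _ = close (joins-sym Hab) eb ja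
    cases (inj₂ ea) (inj₂ ja) _ _ = leaf₁ Hab ja ea
    cases _ _ (inj₂ eb) (inj₂ jb) = leaf₁ (joins-sym Hab) jb eb
    cases (inj₁ ea) (inj₂ _) (inj₁ eb) (inj₂ _) =
      ⊥-elim (h≢e (joins-unique Hab (on-both (loopless G h) ea eb)))
    cases (inj₂ _) (inj₁ ja) (inj₂ _) (inj₁ jb) =
      ⊥-elim (h≢j (joins-unique Hab (on-both (loopless G h) ja jb)))

  -- The head of a list of edges is the latest one: j is dropped when some edge earlier than j closes a
  -- balanced triangle with j and e.
  relevant : Fin m → List (Fin m) → List (Fin m)
  relevant e []       = []
  relevant e (j ∷ es) with any? (λ h → balanced△? h j e) es
  ... | yes _ = relevant e es
  ... | no _  = j ∷ relevant e es

  relevant-⊆ : ∀ e es → relevant e es ⊆ es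
  relevant-⊆ e (j ∷ es) with any? (λ h → balanced△? h j e) es
  ... | yes _ = there ∘ relevant-⊆ e es
  ... | no _  = λ { (here p) → here p ; (there p) → there (relevant-⊆ e es p) }

  ∑-relevant : ∀ e es (f : Fin m → ℕ) → ∑ (relevant e es) f ≤ ∑ es f
  ∑-relevant e []       f = z≤n
  ∑-relevant e (j ∷ es) f with any? (λ h → balanced△? h j e) es
  ... | yes _ = ≤-trans (∑-relevant e es f) (m≤n+m _ (f j))
  ... | no _  = +-monoʳ-≤ (f j) (∑-relevant e es f)

  -- If `j` is kept, no edge earlier than `j` closes a balanced triangle with `j` and `e`. The
  -- second member of a pair is such an earlier edge, so `bound` applies to every pair of kept
  -- edges; the other pairs only enlarge the right side.
  pairs-relevant : ∀ e es (g h : Fin m → Fin m → ℕ) → Unique es →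
    (∀ {j j′} → j ∈ es → j′ ∈ es → j ≢ j′ → ¬ Balanced△ j′ j e → g j j′ ≤ h j j′) →
    pairs g (relevant e es) ≤ pairs h es
  pairs-relevant e []       g h _ _ = z≤n
  pairs-relevant e (j ∷ es) g h (j∉ ∷ u) bound with any? (λ i → balanced△? i j e) es
  ... | yes _ = ≤-trans (pairs-relevant e es g h u (λ p q → bound (there p) (there q))) (m≤n+m _ (∑ es (h j)))
  ... | no ¬b = +-mono-≤
    (≤-trans (∑-mono-∈ (relevant e es) (λ p → let q = relevant-⊆ e es p in
               bound (here refl) (there q) (All.lookup j∉ q) (λ b → ¬b (lose q b))))
             (∑-relevant e es (h j)))
    (pairs-relevant e es g h u (λ p q → bound (there p) (there q)))

  -- Truncated inclusion-exclusion for a single colouring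

  ok : List (Fin m) → Colouring n → ℕ
  ok []       c = 1
  ok (e ∷ es) c = 𝟙 (¬? (violates? e c)) * ok es c

  ok-none : ∀ es {c} → (∀ i → ¬ Violates i c) → ok es c ≡ 1
  ok-none []       h = refl
  ok-none (e ∷ es) {c} h rewrite 𝟙-true (¬? (violates? e c)) (h e) | ok-none es {c} h = refl

  ok-some : ∀ {es i c} → i ∈ es → Violates i c → ok es c ≡ 0
  ok-some {i ∷ es} {c = c} (here refl) v rewrite 𝟙-false (¬? (violates? i c)) (λ f → f v) = refl
  ok-some {e ∷ es} {c = c} (there p) v rewrite ok-some {es} {c = c} p v = *-zeroʳ (𝟙 (¬? (violates? e c)))

  ok-step : ∀ e es c → ok (e ∷ es) c + x e c * ok es c ≡ ok es c
  ok-step e es c with violates? e c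
  ... | yes _ = +-identityʳ _
  ... | no _  = trans (+-identityʳ _) (+-identityʳ _)

  ok-proper : ∀ c → ok (allFin m) c ≡ 𝟙 (proper? G c)
  ok-proper c = case proper? G c of λ where
    (yes p) → trans (ok-none (allFin m) {c} p) (sym (𝟙-true (proper? G c) p))
    (no ¬p) → let i , ¬¬v = FinP.¬∀⟶∃¬ m _ (λ i → ¬? (violates? i c)) ¬p in
      trans (ok-some {c = c} (∈-allFin i) (case violates? i c of λ where
               (yes v) → v
               (no ¬v) → ⊥-elim (¬¬v ¬v)))
            (sym (𝟙-false (proper? G c) ¬p))

  -- A colouring violating `e` and some edge of `es` violates a kept one: a violated discarded edge
  -- points to a violated edge earlier than itself, and this descent ends at a kept edge.
  ok-upper : ∀ e es c → x e c ≤ x e c * ok es c + ∑ (relevant e es) (λ j → x e c * x j c)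
  ok-upper e es c with violates? e c
  ... | no _ = z≤n
  ... | yes ve = subst (1 ≤_) (cong₂ _+_ (sym (+-identityʳ (ok es c)))
                                 (∑-cong (relevant e es) (λ j → sym (+-identityʳ (x j c))))) (go es)
    where
    go : ∀ es → 1 ≤ ok es c + ∑ (relevant e es) (λ j → x j c)
    go [] = s≤s z≤n
    go (j ∷ es) with any? (λ h → balanced△? h j e) es
    go (j ∷ es) | no _ with violates? j c
    ... | yes _ = s≤s z≤n
    ... | no _  = subst (λ z → 1 ≤ z + ∑ (relevant e es) (λ i → x i c)) (sym (+-identityʳ (ok es c))) (go es)
    go (j ∷ es) | yes p with violates? j c
    ... | no _  = subst (λ z → 1 ≤ z + ∑ (relevant e es) (λ i → x i c)) (sym (+-identityʳ (ok es c))) (go es)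
    -- The violated edge `h` makes `ok es c` vanish, so the induction hypothesis already finds its 1
    -- in the sum over kept edges.
    ... | yes vj with h , h∈ , b ← find p =
      subst (λ z → 1 ≤ z + ∑ (relevant e es) (λ i → x i c))
            (ok-some {es} {c = c} h∈ (balanced△-violates {c = c} b vj ve)) (go es)

  -- Bonferroni: when `t` kept edges are violated, `t` is at most 1 plus the number of pairs of them
  -- if `t` is positive, and `ok` is then 0. Discarded edges occur only in `ok`, which they can only
  -- lower.
  ok-lower : ∀ e es c →
    x e c * ok es c + ∑ (relevant e es) (λ j → x e c * x j c) ≤
    x e c + pairs (λ j j′ → x e c * (x j c * x j′ c)) (relevant e es)
  ok-lower e es c with violates? e c
  ... | no _ = ≤-trans (≤-reflexive (trans (∑-const (relevant e es) 0) (*-zeroʳ (length (relevant e es))))) z≤n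
  ... | yes _ = go es
    where
    go : ∀ es → 1 * ok es c + ∑ (relevant e es) (λ j → 1 * x j c) ≤
                1 + pairs (λ j j′ → 1 * (x j c * x j′ c)) (relevant e es)
    go [] = ≤-refl
    go (j ∷ es) with any? (λ h → balanced△? h j e) es
    go (j ∷ es) | yes _ = ≤-trans (+-monoˡ-≤ _ (*-monoʳ-≤ 1 lemma)) (go es)
      where
      lemma : ok (j ∷ es) c ≤ ok es c
      lemma = ≤-trans (m≤m+n _ _) (≤-reflexive (ok-step j es c))
    go (j ∷ es) | no _ with violates? j c
    -- Now `ok` is 0, and the pairs containing `j` count exactly the remaining violated kept edges.
    ... | yes _ = s≤s (≤-trans (≤-reflexive (∑-cong (relevant e es) (λ i → sym (+-identityʳ (1 * x i c))))) (≤-trans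
        (≤-reflexive (∑-cong (relevant e es) (λ i → lemma (x i c)))) (m≤m+n _ _)))
      where
      lemma : ∀ z → 1 * z + 0 ≡ 1 * (1 * z)
      lemma = solve-∀
    ... | no _  = ≤-trans (≤-reflexive (cong (λ z → 1 * z + ∑ (relevant e es) (λ i → 1 * x i c)) (+-identityʳ (ok es c))))
        (≤-trans (go es) (s≤s (m≤n+m _ _)))

-- Counting colourings that violate given edges

module Resampling {n : ℕ} (L : ListAssignment n) {k : ℕ}
  (uniq : ∀ v → Unique (L v)) (len : ∀ v → length (L v) ≡ k) where

  Cs : List (Colouring n)
  Cs = choices L

  -- The condition forces the colour of `u` to a value `t c` computed from the other vertices.
  -- Resampling `u` hits that value `mult (L u) (t c)` times among `k` trials.
  determined : ∀ u {Q : Colouring n → ℕ} {t : Colouring n → ℤ} → Indep u Q → Indep u t →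
    k * ∑ Cs (λ c → Q c * 𝟙 (c u ℤ.≟ t c)) ≡ ∑ Cs (λ c → Q c * mult (L u) (t c))
  determined u {Q} {t} iQ it = begin
    k * ∑ Cs F                                               ≡⟨ cong (_* ∑ Cs F) (sym (len u)) ⟩
    length (L u) * ∑ Cs F                                    ≡⟨ resample L u F ext ⟩
    ∑ Cs (λ c → ∑ (L u) (λ a → F (updateAt c u (const a))))  ≡⟨ ∑-cong Cs (λ c → ∑-cong (L u) (upd c)) ⟩
    ∑ Cs (λ c → ∑ (L u) (λ a → Q c * 𝟙 (a ℤ.≟ t c)))         ≡⟨ ∑-cong Cs (λ c → ∑-*ˡ (L u) (Q c) _) ⟩
    ∑ Cs (λ c → Q c * mult (L u) (t c))                      ∎
    where
    open ≡-Reasoning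
    F : Colouring n → ℕ
    F c = Q c * 𝟙 (c u ℤ.≟ t c)
    ext : Ext F
    ext c c′ h rewrite h u | Indep⇒Ext iQ c c′ h | Indep⇒Ext it c c′ h = refl
    upd : ∀ c a → F (updateAt c u (const a)) ≡ Q c * 𝟙 (a ℤ.≟ t c)
    upd c a rewrite updateAt-updates u {const a} c
                  | iQ _ c (λ v v≢u → updateAt-minimal v u {const a} c v≢u)
                  | it _ c (λ v v≢u → updateAt-minimal v u {const a} c v≢u) = refl

  determined-≤ : ∀ u {Q : Colouring n → ℕ} {t : Colouring n → ℤ} → Indep u Q → Indep u t →
    k * ∑ Cs (λ c → Q c * 𝟙 (c u ℤ.≟ t c)) ≤ ∑ Cs Q
  determined-≤ u {Q} {t} iQ it = ≤-trans (≤-reflexive (determined u iQ it))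
    (∑-mono Cs (λ c → ≤-trans (*-monoʳ-≤ (Q c) (mult≤1 (t c) (uniq u))) (≤-reflexive (*-identityʳ (Q c)))))

  total : ∑ Cs (λ _ → 1) ≡ k ^ n
  total = ∑-choices-1 L len

  -- The vertices are freed one at a time, each gaining a factor `k`. The leading 1 serves as the
  -- `Q` of the last application of `determined-≤`.
  three-zeros : ∀ {u v w} → u ≢ v → u ≢ w → v ≢ w →
    k * (k * (k * ∑ Cs (λ c → (1 * 𝟙 (c w ℤ.≟ ℤ.0ℤ)) * 𝟙 (c v ℤ.≟ ℤ.0ℤ) * 𝟙 (c u ℤ.≟ ℤ.0ℤ)))) ≤ k ^ n
  three-zeros {u} {v} {w} u≢v u≢w v≢w = begin
    k * (k * (k * _))  ≤⟨ *-monoʳ-≤ k (*-monoʳ-≤ k (determined-≤ u indep₂ (λ _ _ _ → refl))) ⟩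
    k * (k * _)        ≤⟨ *-monoʳ-≤ k (determined-≤ v indep₁ (λ _ _ _ → refl)) ⟩
    k * _              ≤⟨ determined-≤ w (λ _ _ _ → refl) (λ _ _ _ → refl) ⟩
    _                  ≡⟨ total ⟩
    k ^ n              ∎
    where
    open ≤-Reasoning
    indep₁ : Indep v (λ c → 1 * 𝟙 (c w ℤ.≟ ℤ.0ℤ))
    indep₁ c c′ h rewrite h w (v≢w ∘ sym) = refl
    indep₂ : Indep u (λ c → (1 * 𝟙 (c w ℤ.≟ ℤ.0ℤ)) * 𝟙 (c v ℤ.≟ ℤ.0ℤ))
    indep₂ c c′ h rewrite h w (u≢w ∘ sym) | h v (u≢v ∘ sym) = refl

  module _ {m : ℕ} (G : SignedGraph n m) where

    open Graph G

    f₁ : Fin m → ℕ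
    f₁ i = ∑ Cs (x i)

    f₂ : Fin m → Fin m → ℕ
    f₂ i j = ∑ Cs (λ c → x i c * x j c)

    f₃ : Fin m → Fin m → Fin m → ℕ
    f₃ i j l = ∑ Cs (λ c → x i c * (x j c * x l c))

    -- Since `Q` does not read `u`, the edge `i` acts as a pendant edge at `u`: violating it forces
    -- the colour of `u` from that of `v`.
    pendant : ∀ {i u v Q} → Joins G i u v → Indep u Q →
      k * ∑ Cs (λ c → Q c * x i c) ≡ ∑ Cs (λ c → Q c * mult (L u) (⟦ σ G i ⟧ ℤ.* c v))
    pendant {i} {u} {v} {Q} J iQ =
      trans (cong (k *_) (∑-cong Cs (λ c → cong (Q c *_) (x-joins J c))))
            (determined u iQ (λ c c′ h → cong (⟦ σ G i ⟧ ℤ.*_) (h v (joins-≢ J ∘ sym))))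

    pendant-≤ : ∀ {i u v Q} → Joins G i u v → Indep u Q → k * ∑ Cs (λ c → Q c * x i c) ≤ ∑ Cs Q
    pendant-≤ {i} {u} {v} {Q} J iQ =
      ≤-trans (≤-reflexive (cong (k *_) (∑-cong Cs (λ c → cong (Q c *_) (x-joins J c)))))
              (determined-≤ u iQ (λ c c′ h → cong (⟦ σ G i ⟧ ℤ.*_) (h v (joins-≢ J ∘ sym))))

    f₁-mult : ∀ {i u v} → Joins G i u v → k * f₁ i ≡ ∑ Cs (λ c → mult (L u) (⟦ σ G i ⟧ ℤ.* c v))
    f₁-mult {i} {u} {v} J = begin
      k * f₁ i                     ≡⟨ cong (k *_) (∑-cong Cs (λ c → sym (*-identityˡ (x i c)))) ⟩
      k * ∑ Cs (λ c → 1 * x i c)    ≡⟨ pendant {Q = const 1} J (λ _ _ _ → refl) ⟩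
      ∑ Cs (λ c → 1 * mult (L u) (⟦ σ G i ⟧ ℤ.* c v))
        ≡⟨ ∑-cong Cs (λ c → *-identityˡ (mult (L u) (⟦ σ G i ⟧ ℤ.* c v))) ⟩
      ∑ Cs (λ c → mult (L u) (⟦ σ G i ⟧ ℤ.* c v))  ∎
      where open ≡-Reasoning

    f₁-≤ : ∀ i → k * f₁ i ≤ k ^ n
    f₁-≤ i = begin
      k * f₁ i                     ≡⟨ cong (k *_) (∑-cong Cs (λ c → sym (*-identityˡ (x i c)))) ⟩
      k * ∑ Cs (λ c → 1 * x i c)    ≤⟨ pendant-≤ {Q = const 1} (inj₁ (refl , refl)) (λ _ _ _ → refl) ⟩
      ∑ Cs (λ _ → 1)                ≡⟨ total ⟩
      k ^ n                        ∎
      where open ≤-Reasoning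

    f₂-≤ : ∀ {i j} → i ≢ j → k * (k * f₂ i j) ≤ k ^ n
    f₂-≤ {i} {j} i≢j with _ , _ , J , off ← private-end (i≢j ∘ sym) =
      ≤-trans (*-monoʳ-≤ k (pendant-≤ J (x-indep off))) (f₁-≤ i)

    -- Resampling a suitable end of each edge turns both violations into 0/1 functions `μᵢ` and `μⱼ`
    -- of one colouring, even if the edges share a vertex. Then `a + b ≤ a * b + 1` for numbers at
    -- most 1 is summed.
    f₂-≥ : ∀ {i j} → i ≢ j → k * f₁ i + k * f₁ j ≤ k * (k * f₂ i j) + k ^ n
    f₂-≥ {i} {j} i≢j
      with u , v , J , off ← private-end {j} {i} (i≢j ∘ sym)
      -- The end `w` of `i` must differ from `v`, so that resampling `w` leaves `μⱼ`, which reads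
      -- only `c v`, unchanged.
      with w , y , J′ , w≢v ← other-end i v = begin
      k * f₁ i + k * f₁ j
        ≡⟨ cong₂ _+_ (f₁-mult J′) (f₁-mult J) ⟩
      ∑ Cs μᵢ + ∑ Cs μⱼ
        ≡⟨ sym (∑-+ Cs μᵢ μⱼ) ⟩
      ∑ Cs (λ c → μᵢ c + μⱼ c)
        ≤⟨ ∑-mono Cs (λ c → incl-excl (mult≤1 _ (uniq w)) (mult≤1 _ (uniq u))) ⟩
      ∑ Cs (λ c → μⱼ c * μᵢ c + 1)
        ≡⟨ ∑-+ Cs (λ c → μⱼ c * μᵢ c) (λ _ → 1) ⟩
      ∑ Cs (λ c → μⱼ c * μᵢ c) + ∑ Cs (λ _ → 1)
        ≡⟨ cong₂ _+_ (sym eq) total ⟩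
      k * (k * f₂ i j) + k ^ n ∎
      where
      open ≤-Reasoning
      μᵢ μⱼ : Colouring n → ℕ
      μᵢ c = mult (L w) (⟦ σ G i ⟧ ℤ.* c y)
      μⱼ c = mult (L u) (⟦ σ G j ⟧ ℤ.* c v)
      incl-excl : ∀ {a b} → a ≤ 1 → b ≤ 1 → a + b ≤ b * a + 1
      incl-excl {zero}  {b} _ q       = ≤-trans q (m≤n+m 1 (b * 0))
      incl-excl {suc zero} {b} _ _    = ≤-reflexive (lemma b)
        where
        lemma : ∀ b → 1 + b ≡ b * 1 + 1
        lemma = solve-∀
      incl-excl {suc (suc _)} (s≤s ()) _
      eq : k * (k * f₂ i j) ≡ ∑ Cs (λ c → μⱼ c * μᵢ c)
      eq = ≡-Reasoning.begin
        k * (k * f₂ i j)                  ≡-Reasoning.≡⟨ cong (k *_) (pendant J (x-indep off)) ⟩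
        k * ∑ Cs (λ c → x i c * μⱼ c)      ≡-Reasoning.≡⟨ cong (k *_) (∑-cong Cs (λ c → *-comm (x i c) (μⱼ c))) ⟩
        k * ∑ Cs (λ c → μⱼ c * x i c)      ≡-Reasoning.≡⟨ pendant J′ (λ c c′ h →
                                               cong (λ z → mult (L u) (⟦ σ G j ⟧ ℤ.* z)) (h v (w≢v ∘ sym))) ⟩
        ∑ Cs (λ c → μⱼ c * μᵢ c)           ≡-Reasoning.∎

    -- A private end gives a factor `k` and leaves two distinct edges for `f₂-≤`; an unbalanced
    -- triangle forces colour 0 on its three vertices. In a balanced triangle two violations imply
    -- the third, so only the weaker bound of `f₂-≤` would be available.
    f₃-≤ : ∀ {h j e} → h ≢ j → h ≢ e → j ≢ e → ¬ Balanced△ h j e → k * (k * (k * f₃ e j h)) ≤ k ^ n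
    f₃-≤ {h} {j} {e} h≢j h≢e j≢e ¬b with shape h≢j h≢e j≢e
    ... | leaf₁ H offj offe = begin
      k * (k * (k * f₃ e j h))
        ≡⟨ cong (λ z → k * (k * (k * z))) (∑-cong Cs (λ c → sym (*-assoc (x e c) (x j c) (x h c)))) ⟩
      k * (k * (k * ∑ Cs (λ c → x e c * x j c * x h c)))
        ≤⟨ *-monoʳ-≤ k (*-monoʳ-≤ k (pendant-≤ H (λ c c′ q → cong₂ _*_ (x-indep offe c c′ q) (x-indep offj c c′ q)))) ⟩
      k * (k * f₂ e j)
        ≤⟨ f₂-≤ (j≢e ∘ sym) ⟩
      k ^ n ∎
      where open ≤-Reasoning
    ... | leaf₃ E offh offj = begin
      k * (k * (k * f₃ e j h))
        ≡⟨ cong (λ z → k * (k * (k * z))) (∑-cong Cs (λ c → *-comm (x e c) (x j c * x h c))) ⟩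
      k * (k * (k * ∑ Cs (λ c → x j c * x h c * x e c)))
        ≤⟨ *-monoʳ-≤ k (*-monoʳ-≤ k (pendant-≤ E (λ c c′ q → cong₂ _*_ (x-indep offj c c′ q) (x-indep offh c c′ q)))) ⟩
      k * (k * f₂ j h)
        ≤⟨ f₂-≤ (h≢j ∘ sym) ⟩
      k ^ n ∎
      where open ≤-Reasoning
    ... | triangle (u , v , w , H , J , E) = ≤-trans
      (*-monoʳ-≤ k (*-monoʳ-≤ k (*-monoʳ-≤ k (∑-mono Cs bound))))
      (three-zeros (joins-≢ H) (joins-≢ E) (joins-≢ J))
      where
      -- Going around an unbalanced triangle gives c u = - c u.
      zeros : ∀ c → Violates h c → Violates j c → Violates e c →
        c w ≡ ℤ.0ℤ × c v ≡ ℤ.0ℤ × c u ≡ ℤ.0ℤ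
      zeros c vh vj ve = w0 , v0 , u0
        where
        open ≡-Reasoning
        u0 : c u ≡ ℤ.0ℤ
        u0 = ≡neg⇒≡0 (c u) (begin
          c u                                                    ≡⟨ violates⇒ {c = c} E ve ⟩
          ⟦ σ G e ⟧ ℤ.* c w
            ≡⟨ cong (λ s → ⟦ s ⟧ ℤ.* c w) (≢⊗ (σ G e) (σ G h) (σ G j) (λ s → ¬b ((u , v , w , H , J , E) , s))) ⟩
          ⟦ neg ⊗ (σ G h ⊗ σ G j) ⟧ ℤ.* c w                      ≡⟨ ⟦⟧-⊗ neg (σ G h ⊗ σ G j) (c w) ⟩
          ⟦ neg ⟧ ℤ.* (⟦ σ G h ⊗ σ G j ⟧ ℤ.* c w)                ≡⟨ cong (⟦ neg ⟧ ℤ.*_) (⟦⟧-⊗ (σ G h) (σ G j) (c w)) ⟩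
          ⟦ neg ⟧ ℤ.* (⟦ σ G h ⟧ ℤ.* (⟦ σ G j ⟧ ℤ.* c w))
            ≡⟨ cong (λ z → ⟦ neg ⟧ ℤ.* (⟦ σ G h ⟧ ℤ.* z)) (sym (violates⇒ {c = c} J vj)) ⟩
          ⟦ neg ⟧ ℤ.* (⟦ σ G h ⟧ ℤ.* c v)                        ≡⟨ cong (⟦ neg ⟧ ℤ.*_) (sym (violates⇒ {c = c} H vh)) ⟩
          ⟦ neg ⟧ ℤ.* c u                                        ∎)
        v0 : c v ≡ ℤ.0ℤ
        v0 = ⟦⟧*≡⇒≡0 (σ G h) (c v) (trans (sym (violates⇒ {c = c} H vh)) u0)
        w0 : c w ≡ ℤ.0ℤ
        w0 = ⟦⟧*≡⇒≡0 (σ G e) (c w) (trans (sym (violates⇒ {c = c} E ve)) u0)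
      bound : ∀ c → x e c * (x j c * x h c) ≤ (1 * 𝟙 (c w ℤ.≟ ℤ.0ℤ)) * 𝟙 (c v ℤ.≟ ℤ.0ℤ) * 𝟙 (c u ℤ.≟ ℤ.0ℤ)
      bound c with violates? e c | violates? j c | violates? h c
      ... | no _   | _      | _      = z≤n
      ... | yes _  | no _   | _      = z≤n
      ... | yes _  | yes _  | no _   = z≤n
      ... | yes ve | yes vj | yes vh with w0 , v0 , u0 ← zeros c vh vj ve
        rewrite 𝟙-true (c w ℤ.≟ ℤ.0ℤ) w0 | 𝟙-true (c v ℤ.≟ ℤ.0ℤ) v0 | 𝟙-true (c u ℤ.≟ ℤ.0ℤ) u0 = ≤-refl

    N : Fin m → List (Fin m) → ℕ
    N e es = ∑ Cs (λ c → x e c * ok es c)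

    OK : List (Fin m) → ℕ
    OK es = ∑ Cs (ok es)

    OK-step : ∀ e es → OK (e ∷ es) + N e es ≡ OK es
    OK-step e es = trans (sym (∑-+ Cs (ok (e ∷ es)) _)) (∑-cong Cs (ok-step e es))

    PL≡OK : PL G L ≡ OK (allFin m)
    PL≡OK = trans (length-filter≡∑ (proper? G) Cs) (∑-cong Cs (λ c → sym (ok-proper c)))

    N-lower : ∀ e es → f₁ e ≤ N e es + ∑ (relevant e es) (f₂ e)
    N-lower e es = begin
      ∑ Cs (x e)  ≤⟨ ∑-mono Cs (ok-upper e es) ⟩
      ∑ Cs (λ c → x e c * ok es c + ∑ (relevant e es) (λ j → x e c * x j c))  ≡⟨ ∑-+ Cs (λ c → x e c * ok es c) _ ⟩
      N e es + ∑ Cs (λ c → ∑ (relevant e es) (λ j → x e c * x j c))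
        ≡⟨ cong (N e es +_) (∑-swap Cs (relevant e es) (λ c j → x e c * x j c)) ⟩
      N e es + ∑ (relevant e es) (f₂ e) ∎
      where open ≤-Reasoning

    N-upper : ∀ e es → N e es + ∑ (relevant e es) (f₂ e) ≤ f₁ e + pairs (f₃ e) (relevant e es)
    N-upper e es = begin
      N e es + ∑ (relevant e es) (f₂ e)
        ≡⟨ cong (N e es +_) (sym (∑-swap Cs (relevant e es) (λ c j → x e c * x j c))) ⟩
      N e es + ∑ Cs (λ c → ∑ (relevant e es) (λ j → x e c * x j c))
        ≡⟨ sym (∑-+ Cs (λ c → x e c * ok es c) _) ⟩
      ∑ Cs (λ c → x e c * ok es c + ∑ (relevant e es) (λ j → x e c * x j c))
        ≤⟨ ∑-mono Cs (ok-lower e es) ⟩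
      ∑ Cs (λ c → x e c + pairs (λ j j′ → x e c * (x j c * x j′ c)) (relevant e es))
        ≡⟨ ∑-+ Cs (x e) _ ⟩
      f₁ e + ∑ Cs (λ c → pairs (λ j j′ → x e c * (x j c * x j′ c)) (relevant e es))
        ≡⟨ cong (f₁ e +_) (∑-pairs Cs (λ c j j′ → x e c * (x j c * x j′ c)) (relevant e es)) ⟩
      f₁ e + pairs (f₃ e) (relevant e es) ∎
      where open ≤-Reasoning

    -- The truncated subtraction is exact because of `f₁-≤`.
    β : Fin m → ℕ
    β i = k ^ n ∸ k * f₁ i

    f₁+β : ∀ i → k * f₁ i + β i ≡ k ^ n
    f₁+β i = m+[n∸m]≡n (f₁-≤ i)

    f₂+β : ∀ {i j} → i ≢ j → k ^ n ≤ k * (k * f₂ i j) + (β i + β j)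
    f₂+β {i} {j} i≢j = +-cancelʳ-≤ (k ^ n) _ _ (begin
      k ^ n + k ^ n                                  ≡⟨ cong₂ _+_ (sym (f₁+β i)) (sym (f₁+β j)) ⟩
      (k * f₁ i + β i) + (k * f₁ j + β j)            ≡⟨ lemma₁ (k * f₁ i) (β i) (k * f₁ j) (β j) ⟩
      (k * f₁ i + k * f₁ j) + (β i + β j)            ≤⟨ +-monoˡ-≤ (β i + β j) (f₂-≥ i≢j) ⟩
      (k * (k * f₂ i j) + k ^ n) + (β i + β j)       ≡⟨ lemma₂ (k * (k * f₂ i j)) (k ^ n) (β i + β j) ⟩
      k * (k * f₂ i j) + (β i + β j) + k ^ n         ∎)
      where
      open ≤-Reasoning
      lemma₁ : ∀ a b c d → (a + b) + (c + d) ≡ (a + c) + (b + d)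
      lemma₁ = solve-∀
      lemma₂ : ∀ a b c → (a + b) + c ≡ a + c + b
      lemma₂ = solve-∀

    -- As the lists are repetition-free, this is the size of the intersection of
    -- `σ G i · L (end₂ G i)` with `L (end₁ G i)`. It equals `k` exactly when the two lists agree
    -- along the edge.
    matched : Fin m → ℕ
    matched i = ∑ (L (end₂ G i)) (λ a → mult (L (end₁ G i)) (⟦ σ G i ⟧ ℤ.* a))

    -- `f₁-mult` has averaged over the colour of `end₁ G i`; averaging over that of `end₂ G i` as
    -- well leaves a summand independent of the colouring.
    f₁-matched : ∀ i → k * (k * f₁ i) ≡ k ^ n * matched i
    f₁-matched i = begin
      k * (k * f₁ i)                                    ≡⟨ cong (k *_) (f₁-mult (inj₁ (refl , refl))) ⟩
      k * ∑ Cs F                                         ≡⟨ cong (_* ∑ Cs F) (sym (len v)) ⟩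
      length (L v) * ∑ Cs F                              ≡⟨ resample L v F (λ c c′ h → cong (λ z → mult (L (end₁ G i)) (⟦ σ G i ⟧ ℤ.* z)) (h v)) ⟩
      ∑ Cs (λ c → ∑ (L v) (λ a → F (updateAt c v (const a))))
        ≡⟨ ∑-cong Cs (λ c → ∑-cong (L v) (λ a → cong (λ z → mult (L (end₁ G i)) (⟦ σ G i ⟧ ℤ.* z)) (updateAt-updates v c))) ⟩
      ∑ Cs (λ c → matched i)                             ≡⟨ ∑-const Cs (matched i) ⟩
      length Cs * matched i                              ≡⟨ cong (_* matched i) (trans (sym (*-identityʳ (length Cs))) (trans (sym (∑-const Cs 1)) total)) ⟩
      k ^ n * matched i                                 ∎
      where
      open ≡-Reasoning
      v = end₂ G i
      F : Colouring n → ℕ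
      F c = mult (L (end₁ G i)) (⟦ σ G i ⟧ ℤ.* c v)

    -- By integrality a mismatch loses at least one of the `k` possible matches, and each match is
    -- worth `k ^ n` in `f₁-matched`.
    β-large : ∀ i → matched i < k → k ^ n ≤ k * β i
    β-large i lt = +-cancelˡ-≤ (k ^ n * matched i) _ _ (begin
      k ^ n * matched i + k ^ n       ≡⟨ lemma (k ^ n) (matched i) ⟩
      k ^ n * suc (matched i)         ≤⟨ *-monoʳ-≤ (k ^ n) lt ⟩
      k ^ n * k                       ≡⟨ *-comm (k ^ n) k ⟩
      k * k ^ n                       ≡⟨ cong (k *_) (sym (f₁+β i)) ⟩
      k * (k * f₁ i + β i)            ≡⟨ *-distribˡ-+ k (k * f₁ i) (β i) ⟩
      k * (k * f₁ i) + k * β i        ≡⟨ cong (_+ k * β i) (f₁-matched i) ⟩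
      k ^ n * matched i + k * β i     ∎)
      where
      open ≤-Reasoning
      lemma : ∀ a b → a * b + a ≡ a * suc b
      lemma = solve-∀

    -- With `f₁-≤` this is an equality: lists closed along every edge have deficit zero.
    f₁-≥ : (∀ i {a} → a ∈ L (end₂ G i) → ⟦ σ G i ⟧ ℤ.* a ∈ L (end₁ G i)) → ∀ i → k ^ n ≤ k * f₁ i
    f₁-≥ closed i = begin
      k ^ n                                          ≡⟨ sym total ⟩
      ∑ Cs (λ _ → 1)                                  ≤⟨ ∑-mono-∈ Cs (λ {c} c∈ → ∈⇒1≤mult (closed i (∈-choices L c∈ (end₂ G i)))) ⟩
      ∑ Cs (λ c → mult (L (end₁ G i)) (⟦ σ G i ⟧ ℤ.* c (end₂ G i)))  ≡⟨ sym (f₁-mult (inj₁ (refl , refl))) ⟩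
      k * f₁ i                                       ∎
      where open ≤-Reasoning

-- Comparing an assignment with one that is consistent along every edge

cube-+ : ∀ k a b → k * (k * (k * (a + b))) ≡ k * (k * (k * a)) + k * (k * (k * b))
cube-+ = solve-∀

module Comparison {n m : ℕ} (G : SignedGraph n m) {k : ℕ} (L L₀ : ListAssignment n)
  (uniq : ∀ v → Unique (L v)) (len : ∀ v → length (L v) ≡ k)
  (uniq₀ : ∀ v → Unique (L₀ v)) (len₀ : ∀ v → length (L₀ v) ≡ k)
  (closed₀ : ∀ i {a} → a ∈ L₀ (end₂ G i) → ⟦ σ G i ⟧ ℤ.* a ∈ L₀ (end₁ G i)) where

  open Graph G
  module R  = Resampling L uniq len
  module R₀ = Resampling L₀ uniq₀ len₀
  open R using (β)

  K : ℕ
  K = k ^ n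

  -- The bound on `f₃` has denominator `k` cubed, the largest that occurs; scaling by it keeps every
  -- estimate in ℕ.
  cube : ℕ → ℕ
  cube a = k * (k * (k * a))

  cube-mono : ∀ {a b} → a ≤ b → cube a ≤ cube b
  cube-mono h = *-monoʳ-≤ k (*-monoʳ-≤ k (*-monoʳ-≤ k h))

  -- The linear arithmetic of `N-compare`. After scaling, `a`, `b`, `c`, `d` stand for the `N`,
  -- `f₂`, `f₁`, `f₃` terms of `L`, and `a₀`, `b₀`, `c₀` for those of `L₀`; `p` and `q` are the
  -- deficits. The pivot `r` is the generic value of the `f₂` sum, above that of `L₀` and at most
  -- `q` above that of `L`.
  combine : ∀ {a b c d p q t r a₀ b₀ c₀ d′} → a + b ≤ c + d → c + p ≡ t → r ≤ b + q → d ≤ d′ →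
    t ≤ c₀ → c₀ ≤ a₀ + b₀ → b₀ ≤ r → a + p ≤ a₀ + q + d′
  combine {a} {b} {c} {d} {p} {q} {t} {r} {a₀} {b₀} {c₀} {d′} h₁ h₂ h₃ h₄ h₅ h₆ h₇ =
    +-cancelʳ-≤ (b + r) _ _ (begin
      a + p + (b + r)               ≡⟨ lemma₁ a p b r ⟩
      (a + b) + (p + r)             ≤⟨ +-monoˡ-≤ (p + r) h₁ ⟩
      (c + d) + (p + r)             ≡⟨ lemma₂ c d p r ⟩
      (c + p) + (d + r)             ≡⟨ cong (_+ (d + r)) h₂ ⟩
      t + (d + r)                   ≤⟨ +-mono-≤ (≤-trans h₅ (≤-trans h₆ (+-monoʳ-≤ a₀ h₇))) (+-mono-≤ h₄ h₃) ⟩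
      (a₀ + r) + (d′ + (b + q))     ≡⟨ lemma₃ a₀ r d′ b q ⟩
      a₀ + q + d′ + (b + r)         ∎)
    where
    open ≤-Reasoning
    lemma₁ : ∀ a p b r → a + p + (b + r) ≡ (a + b) + (p + r)
    lemma₁ = solve-∀
    lemma₂ : ∀ c d p r → (c + d) + (p + r) ≡ (c + p) + (d + r)
    lemma₂ = solve-∀
    lemma₃ : ∀ a r d b q → (a + r) + (d + (b + q)) ≡ a + q + d + (b + r)
    lemma₃ = solve-∀

  -- The kept edges depend only on `G` and the edge order, so both assignments have the same `f₂`
  -- terms to compare, and their main parts cancel. What remains is the gain from `β G e`, the
  -- deficits in the pairs, and the `f₃` error.
  N-compare : ∀ e es → Unique (e ∷ es) →
    cube (R.N G e es) + k * (k * β G e) ≤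
    cube (R₀.N G e es) + k * ∑ es (λ j → β G e + β G j) + pairs (λ _ _ → K) es
  N-compare e es (e∉ ∷ ues) = ≤-trans
    (combine h₁ h₂ h₃ h₄ h₅ h₆ h₇)
    (+-monoˡ-≤ _ (+-monoʳ-≤ (cube (R₀.N G e es)) (*-monoʳ-≤ k (∑-relevant e es (λ j → β G e + β G j)))))
    where
    open ≤-Reasoning
    ys = relevant e es
    ∑β = ∑ ys (λ j → β G e + β G j)
    e≢ : ∀ {j} → j ∈ es → e ≢ j
    e≢ = All.lookup e∉
    h₁ : cube (R.N G e es) + cube (∑ ys (R.f₂ G e)) ≤ cube (R.f₁ G e) + cube (pairs (R.f₃ G e) ys)
    h₁ = begin
      cube (R.N G e es) + cube (∑ ys (R.f₂ G e))     ≡⟨ sym (cube-+ k _ _) ⟩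
      cube (R.N G e es + ∑ ys (R.f₂ G e))            ≤⟨ cube-mono (R.N-upper G e es) ⟩
      cube (R.f₁ G e + pairs (R.f₃ G e) ys)          ≡⟨ cube-+ k _ _ ⟩
      cube (R.f₁ G e) + cube (pairs (R.f₃ G e) ys)   ∎
    h₂ : cube (R.f₁ G e) + k * (k * β G e) ≡ k * (k * K)
    h₂ = begin-equality
      cube (R.f₁ G e) + k * (k * β G e)       ≡⟨ lemma k (k * R.f₁ G e) (β G e) ⟩
      k * (k * (k * R.f₁ G e + β G e))        ≡⟨ cong (λ z → k * (k * z)) (R.f₁+β G e) ⟩
      k * (k * K)                             ∎
      where
      lemma : ∀ k a b → k * (k * a) + k * (k * b) ≡ k * (k * (a + b))
      lemma = solve-∀
    h₃ : k * (length ys * K) ≤ cube (∑ ys (R.f₂ G e)) + k * ∑β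
    h₃ = begin
      k * (length ys * K)                     ≡⟨ cong (k *_) (sym (∑-const ys K)) ⟩
      k * ∑ ys (λ _ → K)
        ≤⟨ *-monoʳ-≤ k (∑-mono-∈ ys (λ p → R.f₂+β G (e≢ (relevant-⊆ e es p)))) ⟩
      k * ∑ ys (λ j → k * (k * R.f₂ G e j) + (β G e + β G j))
        ≡⟨ cong (k *_) (∑-+ ys _ _) ⟩
      k * (∑ ys (λ j → k * (k * R.f₂ G e j)) + ∑β)
        ≡⟨ *-distribˡ-+ k _ ∑β ⟩
      k * ∑ ys (λ j → k * (k * R.f₂ G e j)) + k * ∑β
        ≡⟨ cong (λ z → k * z + k * ∑β) (trans (∑-*ˡ ys k _) (cong (k *_) (∑-*ˡ ys k _))) ⟩
      cube (∑ ys (R.f₂ G e)) + k * ∑β         ∎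
    h₄ : cube (pairs (R.f₃ G e) ys) ≤ pairs (λ _ _ → K) es
    h₄ = begin
      cube (pairs (R.f₃ G e) ys)
        ≡⟨ sym (trans (pairs-*ˡ k _ ys) (cong (k *_) (trans (pairs-*ˡ k _ ys) (cong (k *_) (pairs-*ˡ k _ ys))))) ⟩
      pairs (λ j j′ → cube (R.f₃ G e j j′)) ys
        ≤⟨ pairs-relevant e es _ _ ues (λ p q j≢j′ ¬b → R.f₃-≤ G (j≢j′ ∘ sym) (e≢ q ∘ sym) (e≢ p ∘ sym) ¬b) ⟩
      pairs (λ _ _ → K) es                    ∎
    h₅ : k * (k * K) ≤ cube (R₀.f₁ G e)
    h₅ = *-monoʳ-≤ k (*-monoʳ-≤ k (R₀.f₁-≥ G closed₀ e))
    h₆ : cube (R₀.f₁ G e) ≤ cube (R₀.N G e es) + cube (∑ ys (R₀.f₂ G e))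
    h₆ = ≤-trans (cube-mono (R₀.N-lower G e es)) (≤-reflexive (cube-+ k _ _))
    h₇ : cube (∑ ys (R₀.f₂ G e)) ≤ k * (length ys * K)
    h₇ = *-monoʳ-≤ k (begin
      k * (k * ∑ ys (R₀.f₂ G e))              ≡⟨ sym (trans (∑-*ˡ ys k _) (cong (k *_) (∑-*ˡ ys k _))) ⟩
      ∑ ys (λ j → k * (k * R₀.f₂ G e j))      ≤⟨ ∑-mono-∈ ys (λ p → R₀.f₂-≤ G (e≢ (relevant-⊆ e es p))) ⟩
      ∑ ys (λ _ → K)                          ≡⟨ ∑-const ys K ⟩
      length ys * K                           ∎)

  -- Summing `N-compare` meets every pair of edges once, so each deficit is charged `length es ∸ 1`
  -- times; the extra `k * B` on the left avoids that subtraction. Pascal's rule accumulates the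
  -- error terms into `length es C 3`.
  OK-compare : ∀ es → Unique es → let B = ∑ es (β G) in
    cube (R₀.OK G es) + (k * (k * B) + k * B) ≤
    cube (R.OK G es) + (k * (length es * B) + (length es C 3) * K)
  OK-compare [] _ = begin
    cube (R₀.OK G []) + (k * (k * 0) + k * 0)  ≡⟨ cong₂ _+_ (cong cube (trans R₀.total (sym R.total))) (lemma k) ⟩
    cube (R.OK G []) + (k * 0 + 0)             ∎
    where
    open ≤-Reasoning
    lemma : ∀ k → k * (k * 0) + k * 0 ≡ k * 0 + 0
    lemma = solve-∀
  OK-compare (e ∷ es) (e∉ ∷ ues) = +-cancelʳ-≤ (cube N₀ + cube N₁) _ _ (begin
    cube O₀′ + (k * (k * (b + B)) + k * (b + B)) + (cube N₀ + cube N₁)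
      ≡⟨ lemma₁ k O₀′ b B N₀ N₁ ⟩
    (cube (O₀′ + N₀) + (k * (k * B) + k * B)) + (cube N₁ + k * (k * b)) + k * b
      ≡⟨ cong (λ z → (cube z + (k * (k * B) + k * B)) + (cube N₁ + k * (k * b)) + k * b) (R₀.OK-step G e es) ⟩
    (cube (R₀.OK G es) + (k * (k * B) + k * B)) + (cube N₁ + k * (k * b)) + k * b
      ≤⟨ +-monoˡ-≤ (k * b) (+-mono-≤ (OK-compare es ues) (N-compare e es (e∉ ∷ ues))) ⟩
    (cube (R.OK G es) + (k * (l * B) + (l C 3) * K))
      + (cube N₀ + k * ∑ es (λ j → b + β G j) + pairs (λ _ _ → K) es) + k * b
      ≡⟨ cong (_+ k * b) (cong₂ _+_
           (cong (λ z → cube z + (k * (l * B) + (l C 3) * K)) (sym (R.OK-step G e es)))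
           (cong₂ (λ y z → cube N₀ + k * y + z)
             (trans (∑-+ es (λ _ → b) (β G)) (cong (_+ B) (∑-const es b)))
             (pairs-const es K))) ⟩
    (cube (O₁′ + N₁) + (k * (l * B) + (l C 3) * K))
      + (cube N₀ + k * (l * b + B) + (l C 2) * K) + k * b
      ≡⟨ lemma₂ k O₁′ b B N₀ N₁ l (l C 3) (l C 2) K ⟩
    cube O₁′ + (k * (suc l * (b + B)) + ((l C 2) + (l C 3)) * K) + (cube N₀ + cube N₁)
      ≡⟨ cong (λ z → cube O₁′ + (k * (suc l * (b + B)) + z * K) + (cube N₀ + cube N₁)) (nCk+nC[k+1]≡[n+1]C[k+1] l 2) ⟩
    cube O₁′ + (k * (suc l * (b + B)) + (suc l C 3) * K) + (cube N₀ + cube N₁)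
      ∎)
    where
    open ≤-Reasoning
    b   = β G e
    B   = ∑ es (β G)
    l   = length es
    O₀′ = R₀.OK G (e ∷ es)
    O₁′ = R.OK G (e ∷ es)
    N₀  = R₀.N G e es
    N₁  = R.N G e es
    lemma₁ : ∀ k O b B N₀ N₁ →
      k * (k * (k * O)) + (k * (k * (b + B)) + k * (b + B)) + (k * (k * (k * N₀)) + k * (k * (k * N₁))) ≡
      (k * (k * (k * (O + N₀))) + (k * (k * B) + k * B)) + (k * (k * (k * N₁)) + k * (k * b)) + k * b
    lemma₁ = solve-∀
    lemma₂ : ∀ k O b B N₀ N₁ l c₃ c₂ K →
      (k * (k * (k * (O + N₁))) + (k * (l * B) + c₃ * K))
        + (k * (k * (k * N₀)) + k * (l * b + B) + c₂ * K) + k * b ≡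
      k * (k * (k * O)) + (k * (suc l * (b + B)) + (c₂ + c₃) * K)
        + (k * (k * (k * N₀)) + k * (k * (k * N₁)))
    lemma₂ = solve-∀

  PL-strict : 1 ≤ k → m + (m C 3) ≤ k → ∀ i → R.matched G i < k → PL G L₀ < PL G L
  -- Were the count for `L` no larger, `key` would squeeze the positive `K` down to 0.
  PL-strict 1≤k bound i lt = ≰⇒> λ PL≤ → <⇒≱ 0<K (+-cancelˡ-≤ (cube O) K 0 (begin
    cube O + K                                ≤⟨ key ⟩
    cube O₁                                   ≤⟨ cube-mono (OK≤ PL≤) ⟩
    cube O                                    ≡⟨ sym (+-identityʳ _) ⟩
    cube O + 0                                ∎))
    where
    open ≤-Reasoning
    O  = R₀.OK G (allFin m)
    O₁ = R.OK G (allFin m)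
    B  = ∑ (allFin m) (β G)
    c₃ = m C 3
    OK≤ : PL G L ≤ PL G L₀ → O₁ ≤ O
    OK≤ p rewrite sym (R₀.PL≡OK G) | sym (R.PL≡OK G) = p
    0<K : 0 < K
    0<K = ≤-trans (≤-reflexive (sym (^-zeroˡ n))) (^-monoˡ-≤ n 1≤k)
    K≤kB : K ≤ k * B
    K≤kB = ≤-trans (R.β-large G i lt) (*-monoʳ-≤ k (member≤∑ (β G) (∈-allFin i)))
    -- The mismatch gives `K ≤ k * B`, used for each of the `c₃ + 1` copies of `K`; `bound` then
    -- fits all `m + c₃ + 1` copies of `k * B` into `k + 1`.
    lower : k * (m * B) + c₃ * K + K ≤ k * (k * B) + k * B
    lower = begin
      k * (m * B) + c₃ * K + K                ≤⟨ +-mono-≤ (+-monoʳ-≤ (k * (m * B)) (*-monoʳ-≤ c₃ K≤kB)) K≤kB ⟩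
      k * (m * B) + c₃ * (k * B) + k * B      ≡⟨ lemma k m B c₃ ⟩
      k * ((m + c₃) * B) + k * B              ≤⟨ +-monoˡ-≤ (k * B) (*-monoʳ-≤ k (*-monoˡ-≤ B bound)) ⟩
      k * (k * B) + k * B                     ∎
      where
      lemma : ∀ k m B c → k * (m * B) + c * (k * B) + k * B ≡ k * ((m + c) * B) + k * B
      lemma = solve-∀
    main : cube O + (k * (k * B) + k * B) ≤ cube O₁ + (k * (m * B) + c₃ * K)
    main = subst (λ l → cube O + (k * (k * B) + k * B) ≤ cube O₁ + (k * (l * B) + (l C 3) * K))
                 (length-tabulate {n = m} (λ i → i)) (OK-compare (allFin m) (UniqueP.allFin⁺ m))
    key : cube O + K ≤ cube O₁
    key = +-cancelʳ-≤ (k * (m * B) + c₃ * K) _ _ (begin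
      cube O + K + (k * (m * B) + c₃ * K)     ≡⟨ lemma (cube O) K (k * (m * B) + c₃ * K) ⟩
      cube O + (k * (m * B) + c₃ * K + K)     ≤⟨ +-monoʳ-≤ (cube O) lower ⟩
      cube O + (k * (k * B) + k * B)          ≤⟨ main ⟩
      cube O₁ + (k * (m * B) + c₃ * K)        ∎)
      where
      lemma : ∀ a b c → a + b + c ≡ a + (c + b)
      lemma = solve-∀

-- The colour set M k

suc-half : ∀ k → suc (suc k) / 2 ≡ suc (k / 2)
suc-half k = m/n≡1+[m∸n]/n {suc (suc k)} {2} (s≤s (s≤s z≤n))

∣M∣-bound : ∀ k {a} → a ∈ M k → ℤ.∣ a ∣ ≤ k / 2
∣M∣-bound (suc zero)    (here refl)         = z≤n
∣M∣-bound (suc (suc k)) (here refl)         = ≤-reflexive (sym (suc-half k))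
∣M∣-bound (suc (suc k)) (there (here refl)) = ≤-reflexive (sym (suc-half k))
∣M∣-bound (suc (suc k)) (there (there p))   =
  ≤-trans (∣M∣-bound k p) (≤-trans (n≤1+n _) (≤-reflexive (sym (suc-half k))))

M-unique : ∀ k → Unique (M k)
M-unique zero          = []
M-unique (suc zero)    = [] ∷ []
M-unique (suc (suc k)) =
  ((λ ()) ∷ All.tabulate (fresh refl)) ∷ All.tabulate (fresh refl) ∷ M-unique k
  where
  fresh : ∀ {a b} → ℤ.∣ a ∣ ≡ suc (k / 2) → b ∈ M k → a ≢ b
  fresh eq b∈ refl = <⇒≱ (n<1+n (k / 2)) (subst (_≤ k / 2) eq (∣M∣-bound k b∈))

M-length : ∀ k → length (M k) ≡ k
M-length zero          = refl
M-length (suc zero)    = refl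
M-length (suc (suc k)) = cong (λ l → suc (suc l)) (M-length k)

M-neg : ∀ k {a} → a ∈ M k → ℤ.- a ∈ M k
M-neg (suc zero)    (here refl)         = here refl
M-neg (suc (suc k)) (here refl)         = there (here refl)
M-neg (suc (suc k)) (there (here refl)) = here refl
M-neg (suc (suc k)) (there (there p))   = there (there (M-neg k p))

M-closed : ∀ k s {a} → a ∈ M k → ⟦ s ⟧ ℤ.* a ∈ M k
M-closed k pos {a} a∈ = subst (_∈ M k) (sym (ℤP.*-identityˡ a)) a∈
M-closed k neg {a} a∈ = subst (_∈ M k) (sym (ℤP.-1*i≡-i a)) (M-neg k a∈)

-- The order-preserving bijection from a k-element set to M k

-- The element of M (p + q + 1) with p smaller and q larger elements.
level : ℕ → ℕ → ℤ
level zero    zero    = ℤ.0ℤ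
level (suc p) zero    = +[1+ p / 2 ]
level zero    (suc q) = -[1+ q / 2 ]
level (suc p) (suc q) = level p q

level∈M : ∀ p q → level p q ∈ M (suc (p + q))
level∈M zero    zero    = here refl
level∈M (suc p) zero    rewrite +-identityʳ p = here refl
level∈M zero    (suc q) = there (here refl)
level∈M (suc p) (suc q) rewrite +-suc p q = there (there (level∈M p q))

level-swap : ∀ p q → level q p ≡ ℤ.- level p q
level-swap zero    zero    = refl
level-swap (suc p) zero    = refl
level-swap zero    (suc q) = refl
level-swap (suc p) (suc q) = level-swap p q

-- Inner levels lie in a smaller colour set, so they never reach the absolute value of the outermost
-- colours.
∣level∣≢ : ∀ p q {a} → ℤ.∣ a ∣ ≡ suc (suc (p + q) / 2) → level p q ≢ a
∣level∣≢ p q eq refl =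
  <⇒≱ (n<1+n (suc (p + q) / 2)) (subst (_≤ suc (p + q) / 2) eq (∣M∣-bound (suc (p + q)) (level∈M p q)))

-- Outermost pairs are peeled off both sides together. When just one side can still be peeled, the
-- other is an extreme colour and `∣level∣≢` separates them; two opposite extremes differ in sign.
level-injective : ∀ p q p′ q′ → p < p′ → p + q ≡ p′ + q′ → level p q ≢ level p′ q′
level-injective zero    (suc q) (suc p′) zero     _ _ ()
level-injective zero    (suc q) (suc p′) (suc q′) _ eq lev =
  ∣level∣≢ p′ q′ (cong (λ z → suc (z / 2)) (trans (suc-injective eq) (+-suc p′ q′))) (sym lev)
level-injective (suc p) (suc q) (suc p′) zero     _ eq =
  ∣level∣≢ p q (cong (λ z → suc (z / 2))
    (trans (trans (sym (+-identityʳ p′)) (sym (suc-injective eq))) (+-suc p q)))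
level-injective (suc p) (suc q) (suc p′) (suc q′) (s≤s lt) eq =
  level-injective p q p′ q′ lt
    (suc-injective (trans (sym (+-suc p q)) (trans (suc-injective eq) (+-suc p′ q′))))
level-injective zero    zero    (suc p′) q′       _ ()
level-injective (suc p) zero    (suc p′) q′ (s≤s lt) eq =
  ⊥-elim (<⇒≱ lt (≤-trans (m≤m+n p′ q′) (≤-reflexive (trans (sym (suc-injective eq)) (+-identityʳ p)))))

below above : List ℤ → ℤ → ℕ
below S a = ∑ S (λ b → 𝟙 (b ℤP.<? a))
above S a = ∑ S (λ b → 𝟙 (a ℤP.<? b))

∈⇒mult≡1 : ∀ {S b} → Unique S → b ∈ S → mult S b ≡ 1
∈⇒mult≡1 {S} {b} u b∈ = ≤-antisym (mult≤1 b u) (∈⇒1≤mult b∈)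

below+above : ∀ {S a} → Unique S → a ∈ S → suc (below S a + above S a) ≡ length S
below+above {S} {a} u a∈ = begin
  suc (below S a + above S a)          ≡⟨ +-comm 1 _ ⟩
  below S a + above S a + 1            ≡⟨ cong (below S a + above S a +_) (sym (∈⇒mult≡1 u a∈)) ⟩
  below S a + above S a + mult S a     ≡⟨ cong (_+ mult S a) (sym (∑-+ S _ _)) ⟩
  ∑ S _ + mult S a                     ≡⟨ sym (∑-+ S _ _) ⟩
  ∑ S (λ b → 𝟙 (b ℤP.<? a) + 𝟙 (a ℤP.<? b) + 𝟙 (b ℤ.≟ a))  ≡⟨ ∑-cong S trichotomy ⟩
  ∑ S (λ _ → 1)                        ≡⟨ ∑-const S 1 ⟩
  length S * 1                         ≡⟨ *-identityʳ _ ⟩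
  length S                             ∎
  where
  open ≡-Reasoning
  trichotomy : ∀ b → 𝟙 (b ℤP.<? a) + 𝟙 (a ℤP.<? b) + 𝟙 (b ℤ.≟ a) ≡ 1
  trichotomy b with ℤP.<-cmp b a
  ... | tri< p q r rewrite 𝟙-true (b ℤP.<? a) p | 𝟙-false (a ℤP.<? b) r | 𝟙-false (b ℤ.≟ a) q = refl
  ... | tri≈ p q r rewrite 𝟙-false (b ℤP.<? a) p | 𝟙-false (a ℤP.<? b) r | 𝟙-true (b ℤ.≟ a) q = refl
  ... | tri> p q r rewrite 𝟙-false (b ℤP.<? a) p | 𝟙-true (a ℤP.<? b) r | 𝟙-false (b ℤ.≟ a) q = refl

below-strict : ∀ {S a b} → a ∈ S → a ℤ.< b → below S a < below S b
below-strict {S} {a} {b} a∈ a<b = begin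
  suc (below S a)                                 ≡⟨ +-comm 1 _ ⟩
  below S a + 1                                   ≤⟨ +-monoʳ-≤ (below S a) (∈⇒1≤mult a∈) ⟩
  below S a + mult S a                            ≡⟨ sym (∑-+ S _ _) ⟩
  ∑ S (λ c → 𝟙 (c ℤP.<? a) + 𝟙 (c ℤ.≟ a))         ≤⟨ ∑-mono S pointwise ⟩
  below S b                                       ∎
  where
  open ≤-Reasoning
  pointwise : ∀ c → 𝟙 (c ℤP.<? a) + 𝟙 (c ℤ.≟ a) ≤ 𝟙 (c ℤP.<? b)
  pointwise c with ℤP.<-cmp c a
  ... | tri< p q _ rewrite 𝟙-true (c ℤP.<? a) p | 𝟙-false (c ℤ.≟ a) q | 𝟙-true (c ℤP.<? b) (ℤP.<-trans p a<b) = ≤-refl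
  ... | tri≈ p refl _ rewrite 𝟙-false (c ℤP.<? c) p | 𝟙-true (c ℤ.≟ c) refl | 𝟙-true (c ℤP.<? b) a<b = ≤-refl
  ... | tri> p q _ rewrite 𝟙-false (c ℤP.<? a) p | 𝟙-false (c ℤ.≟ a) q = z≤n

standardise : List ℤ → ℤ → ℤ
standardise S a = level (below S a) (above S a)

standardise-injective : ∀ {S a b} → Unique S → a ∈ S → b ∈ S → standardise S a ≡ standardise S b → a ≡ b
standardise-injective {S} {a} {b} u a∈ b∈ eq with ℤP.<-cmp a b
... | tri≈ _ a≡b _ = a≡b
... | tri< a<b _ _ = ⊥-elim (level-injective _ (above S a) _ (above S b) (below-strict a∈ a<b)
        (suc-injective (trans (below+above u a∈) (sym (below+above u b∈)))) eq)
... | tri> _ _ b<a = ⊥-elim (level-injective _ (above S b) _ (above S a) (below-strict b∈ b<a)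
        (suc-injective (trans (below+above u b∈) (sym (below+above u a∈)))) (sym eq))

unique-map : {A B : Set} {f : A → B} {xs : List A} →
  (∀ {x y} → x ∈ xs → y ∈ xs → f x ≡ f y → x ≡ y) → Unique xs → Unique (map f xs)
unique-map inj [] = []
unique-map inj (x∉ ∷ u) =
  AllP.map⁺ (All.tabulate (λ y∈ eq → All.lookup x∉ y∈ (inj (here refl) (there y∈) eq)))
  ∷ unique-map (λ p q → inj (there p) (there q)) u

-- An injection into `M k` from a set of the same size is a bijection.
standardise-↭ : ∀ {S k} → Unique S → length S ≡ k → map (standardise S) S ↭ M k
standardise-↭ {S} {k} u len = unique-⊆⇒↭
  (unique-map (standardise-injective u) u)
  (λ p → let a , a∈ , eq = ∈-map⁻ (standardise S) p in
     subst (_∈ M k) (sym eq) (subst (λ z → standardise S a ∈ M z) (trans (below+above u a∈) len)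
       (level∈M (below S a) (above S a))))
  (≤-reflexive (trans (M-length k) (sym (trans (length-map (standardise S) S) len))))

⟦⟧-injective : ∀ s {a b : ℤ} → ⟦ s ⟧ ℤ.* a ≡ ⟦ s ⟧ ℤ.* b → a ≡ b
⟦⟧-injective s {a} {b} eq = trans (sym (⟦⟧-invol s a)) (trans (cong (⟦ s ⟧ ℤ.*_) eq) (⟦⟧-invol s b))

·-⊆⇒↭ : ∀ s {S T} → Unique T → length S ≡ length T → (s · T) ⊆ S → (s · T) ↭ S
·-⊆⇒↭ s {S} {T} u len sub = unique-⊆⇒↭ (UniqueP.map⁺ (⟦⟧-injective s) u) sub
  (≤-reflexive (trans len (sym (length-map (⟦ s ⟧ ℤ.*_) T))))

-- Negation reverses the order, so it exchanges `below` with `above`, and `level-swap` turns that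
-- exchange into a change of sign.
standardise-· : ∀ s {S T} → (s · T) ↭ S → ∀ a → standardise S (⟦ s ⟧ ℤ.* a) ≡ ⟦ s ⟧ ℤ.* standardise T a
standardise-· pos {S} {T} p a = begin
  level (below S (⟦ pos ⟧ ℤ.* a)) (above S (⟦ pos ⟧ ℤ.* a))
    ≡⟨ cong₂ level
         (trans (sym (∑-↭ _ p)) (trans (∑-map (⟦ pos ⟧ ℤ.*_) T _)
           (∑-cong T (λ b → cong₂ (λ y z → 𝟙 (y ℤP.<? z)) (ℤP.*-identityˡ b) (ℤP.*-identityˡ a)))))
         (trans (sym (∑-↭ _ p)) (trans (∑-map (⟦ pos ⟧ ℤ.*_) T _)
           (∑-cong T (λ b → cong₂ (λ y z → 𝟙 (y ℤP.<? z)) (ℤP.*-identityˡ a) (ℤP.*-identityˡ b))))) ⟩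
  standardise T a                 ≡⟨ sym (ℤP.*-identityˡ _) ⟩
  ⟦ pos ⟧ ℤ.* standardise T a     ∎
  where open ≡-Reasoning
standardise-· neg {S} {T} p a = begin
  level (below S (⟦ neg ⟧ ℤ.* a)) (above S (⟦ neg ⟧ ℤ.* a))
    ≡⟨ cong₂ level
         (trans (sym (∑-↭ _ p)) (trans (∑-map (⟦ neg ⟧ ℤ.*_) T _) (∑-cong T (λ b → flip b a))))
         (trans (sym (∑-↭ _ p)) (trans (∑-map (⟦ neg ⟧ ℤ.*_) T _) (∑-cong T (λ b → flip a b)))) ⟩
  level (above T a) (below T a)   ≡⟨ level-swap (below T a) (above T a) ⟩
  ℤ.- standardise T a             ≡⟨ sym (ℤP.-1*i≡-i _) ⟩
  ⟦ neg ⟧ ℤ.* standardise T a     ∎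
  where
  open ≡-Reasoning
  flip : ∀ b c → 𝟙 ((⟦ neg ⟧ ℤ.* b) ℤP.<? (⟦ neg ⟧ ℤ.* c)) ≡ 𝟙 (c ℤP.<? b)
  flip b c = trans (cong₂ (λ y z → 𝟙 (y ℤP.<? z)) (ℤP.-1*i≡-i b) (ℤP.-1*i≡-i c))
    (𝟙-cong ((ℤ.- b) ℤP.<? (ℤ.- c)) (c ℤP.<? b) ℤP.neg-cancel-< ℤP.neg-mono-<)

-- Vertexwise standardisation is a bijection onto the colourings from `M k`. It commutes with the
-- sign of each edge, so a violation in `c` persists in `std c`, and proper images come only from
-- proper colourings.
P≤PL : ∀ {n m k} (G : SignedGraph n m) (L : ListAssignment n) →
  (∀ v → Unique (L v)) → (∀ v → length (L v) ≡ k) →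
  (∀ i → (σ G i · L (end₂ G i)) ↭ L (end₁ G i)) → P G k ≤ PL G L
P≤PL {k = k} G L u len cons = begin
  P G k                                           ≡⟨ length-filter≡∑ (proper? G) (choices (λ _ → M k)) ⟩
  ∑ (choices (λ _ → M k)) (λ c → 𝟙 (proper? G c))
    ≡⟨ ∑-choices-↭ (λ _ → M k) L (λ v → standardise (L v)) (λ v → standardise-↭ (u v) (len v)) _ ext ⟩
  ∑ (choices L) (λ c → 𝟙 (proper? G (std c)))
    ≤⟨ ∑-mono (choices L) (λ c → 𝟙-mono (proper? G (std c)) (proper? G c) (reflect c)) ⟩
  ∑ (choices L) (λ c → 𝟙 (proper? G c))           ≡⟨ sym (length-filter≡∑ (proper? G) (choices L)) ⟩
  PL G L                                          ∎
  where
  open ≤-Reasoning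
  std : Colouring _ → Colouring _
  std c v = standardise (L v) (c v)
  ext : Ext (λ c → 𝟙 (proper? G c))
  ext c c′ h = 𝟙-cong (proper? G c) (proper? G c′)
    (λ pr i eq → pr i (trans (h _) (trans eq (cong (⟦ σ G i ⟧ ℤ.*_) (sym (h _))))))
    (λ pr i eq → pr i (trans (sym (h _)) (trans eq (cong (⟦ σ G i ⟧ ℤ.*_) (h _)))))
  reflect : ∀ c → Proper G (std c) → Proper G c
  reflect c pr i eq = pr i (trans (cong (standardise (L (end₁ G i))) eq)
    (standardise-· (σ G i) (cons i) (c (end₂ G i))))

-- Signed equality of lists around a cycle

-- Equivalent to `S ≈ (s · T)`, but visibly symmetric and composable, with signs multiplying along a
-- walk.
record _~[_]_ (S : List ℤ) (s : Sign) (T : List ℤ) : Set where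
  constructor mk~
  field
    to   : ∀ {a} → a ∈ S → ⟦ s ⟧ ℤ.* a ∈ T
    from : ∀ {a} → a ∈ T → ⟦ s ⟧ ℤ.* a ∈ S

~-sym : ∀ {S T s} → S ~[ s ] T → T ~[ s ] S
~-sym (mk~ f g) = mk~ g f

⊗-comm : ∀ s t → s ⊗ t ≡ t ⊗ s
⊗-comm pos pos = refl
⊗-comm pos neg = refl
⊗-comm neg pos = refl
⊗-comm neg neg = refl

~-trans : ∀ {S T U s t} → S ~[ s ] T → T ~[ t ] U → S ~[ s ⊗ t ] U
~-trans {S} {T} {U} {s} {t} (mk~ f g) (mk~ f′ g′) = mk~
  (λ {a} a∈ → subst (_∈ U) (trans (sym (⟦⟧-⊗ t s a)) (cong (λ r → ⟦ r ⟧ ℤ.* a) (⊗-comm t s))) (f′ (f a∈)))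
  (λ {a} a∈ → subst (_∈ S) (sym (⟦⟧-⊗ s t a)) (g (g′ a∈)))

~⇒≈ : ∀ {S T s} → S ~[ s ] T → S ≈ (s · T)
~⇒≈ {S} {T} {s} (mk~ f g) a =
  (λ a∈ → subst (_∈ (s · T)) (⟦⟧-invol s a) (∈-map⁺ (⟦ s ⟧ ℤ.*_) (f a∈))) ,
  (λ a∈ → let b , b∈ , eq = ∈-map⁻ (⟦ s ⟧ ℤ.*_) a∈ in subst (_∈ S) (sym eq) (g b∈))

≈⇒~ : ∀ {S T s} → S ≈ (s · T) → S ~[ s ] T
≈⇒~ {S} {T} {s} h = mk~
  (λ {a} a∈ → let b , b∈ , eq = ∈-map⁻ (⟦ s ⟧ ℤ.*_) (proj₁ (h a) a∈) in
     subst (_∈ T) (trans (sym (⟦⟧-invol s b)) (cong (⟦ s ⟧ ℤ.*_) (sym eq))) b∈)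
  (λ {a} a∈ → proj₂ (h _) (∈-map⁺ (⟦ s ⟧ ℤ.*_) a∈))

-- Conjugating by `s` preserves `neg`, as signs commute and square to `pos`; splitting on `s` lets
-- the product compute.
~neg-transport : ∀ s {S T} → S ~[ s ] T → T ~[ neg ] T → S ~[ neg ] S
~neg-transport pos p q = ~-trans (~-trans p q) (~-sym p)
~neg-transport neg p q = ~-trans (~-trans p q) (~-sym p)

parity : ℕ → Sign
parity zero    = pos
parity (suc n) = neg ⊗ parity n

odd⇒parity≡neg : ∀ n → n % 2 ≡ 1 → parity n ≡ neg
odd⇒parity≡neg (suc zero)    _ = refl
odd⇒parity≡neg (suc (suc n)) p = cong (λ s → neg ⊗ (neg ⊗ s)) (odd⇒parity≡neg n p)

-- The sign of a walk is the product of its edge signs, which is the parity of its negative edges.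
-- The closing edge is separate because it wraps around; `U` will be the starting list.
walk : ∀ {m} l (edges : Fin (suc l) → Fin m) (sg : Fin m → Sign) (S : Fin (suc l) → List ℤ) {U} →
  (∀ i → S (inject₁ i) ~[ sg (edges (inject₁ i)) ] S (suc i)) →
  S (fromℕ l) ~[ sg (edges (fromℕ l)) ] U →
  S zero ~[ parity (countNeg edges sg) ] U
walk zero edges sg S step last with sg (edges zero)
... | pos = last
... | neg = last
walk (suc l) edges sg S step last
  with sg (edges zero) | step zero | walk l (edges ∘ suc) sg (S ∘ suc) (step ∘ suc) last
... | pos | p | q = ~-trans p q
... | neg | p | q = ~-trans p q

next-inject₁ : ∀ {l} (i : Fin l) → next (inject₁ i) ≡ suc i
next-inject₁ {l} i with suc (toℕ (inject₁ i)) <? suc l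
... | yes p = FinP.toℕ-injective (trans (FinP.toℕ-fromℕ< p) (cong suc (FinP.toℕ-inject₁ i)))
... | no ¬p = ⊥-elim (¬p (s≤s (subst (_< l) (sym (FinP.toℕ-inject₁ i)) (FinP.toℕ<n i))))

next-fromℕ : ∀ l → next (fromℕ l) ≡ zero
next-fromℕ l with suc (toℕ (fromℕ l)) <? suc l
... | yes p = ⊥-elim (<-irrefl (FinP.toℕ-fromℕ l) (≤-pred p))
... | no _  = refl

module _ {n m : ℕ} (G : SignedGraph n m) (L : ListAssignment n)
  (cons : ∀ i → L (end₁ G i) ≈ (σ G i · L (end₂ G i))) where

  joins⇒~ : ∀ {i u v} → Joins G i u v → L u ~[ σ G i ] L v
  joins⇒~ {i} (inj₁ (refl , refl)) = ≈⇒~ (cons i)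
  joins⇒~ {i} (inj₂ (refl , refl)) = ~-sym (≈⇒~ (cons i))

  -- One odd turn gives self-negation at `verts zero`; each step of the walk then carries it to the
  -- following vertex.
  closed-walk : ∀ l (verts : Fin (suc l) → Fin n) (edges : Fin (suc l) → Fin m) →
    (∀ i → Joins G (edges i) (verts i) (verts (next i))) → countNeg edges (σ G) % 2 ≡ 1 →
    ∀ j → L (verts j) ~[ neg ] L (verts j)
  closed-walk l verts edges js odd = <-weakInduction _
    (subst (λ s → L (verts zero) ~[ s ] L (verts zero)) (odd⇒parity≡neg (countNeg edges (σ G)) odd)
      (walk l edges (σ G) (L ∘ verts) step
        (joins⇒~ (subst (λ v → Joins G (edges (fromℕ l)) (verts (fromℕ l)) (verts v)) (next-fromℕ l) (js (fromℕ l))))))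
    (λ i → ~neg-transport (σ G (edges (inject₁ i))) (~-sym (step i)))
    where
    step : ∀ i → L (verts (inject₁ i)) ~[ σ G (edges (inject₁ i)) ] L (verts (suc i))
    step i = joins⇒~ (subst (λ v → Joins G (edges (inject₁ i)) (verts (inject₁ i)) (verts v)) (next-inject₁ i) (js (inject₁ i)))

  cycle-symmetric : (Z : Cycle G) → UnbalancedCycle {Σg = G} Z → ∀ j → L (vs Z j) ~[ neg ] L (vs Z j)
  cycle-symmetric record { ℓ = suc l ; vs = verts ; es = edges ; joins = js } odd =
    closed-walk l verts edges js odd

  connected-symmetric : ∀ {u v} → Connected G u v → L v ~[ neg ] L v → L u ~[ neg ] L u
  connected-symmetric ε              p = p
  connected-symmetric ((i , J) ◅ ps) p = ~neg-transport (σ G i) (joins⇒~ J) (connected-symmetric ps p)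

-- Strict inequality or consistency, and the theorem

all-positive : {A : Set} (xs : List A) {f : A → ℕ} → (∀ x → f x ≤ 1) → length xs ≤ ∑ xs f →
  ∀ {x} → x ∈ xs → 1 ≤ f x
all-positive (x ∷ xs) {f} f≤1 h (here refl) = +-cancelʳ-≤ (length xs) 1 (f x)
  (≤-trans h (+-monoʳ-≤ (f x) (≤-trans (∑-mono xs f≤1) (≤-reflexive (trans (∑-const xs 1) (*-identityʳ _))))))
all-positive (x ∷ xs) {f} f≤1 h (there p) = all-positive xs f≤1
  (≤-pred (≤-trans h (+-monoˡ-≤ (∑ xs f) (f≤1 x)))) p

module _ {n m k : ℕ} (G : SignedGraph n m) (L : ListAssignment n)
  (uniq : ∀ v → Unique (L v)) (len : ∀ v → length (L v) ≡ k) where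

  open Resampling L uniq len

  -- `matched` is a sum of `k` terms, each at most 1. If it reaches `k`, none vanishes, so every
  -- signed colour occurs at the other end, and equal sizes do the rest.
  matched≮⇒↭ : ∀ i → ¬ matched G i < k → (σ G i · L (end₂ G i)) ↭ L (end₁ G i)
  matched≮⇒↭ i ≮k = ·-⊆⇒↭ (σ G i) (uniq _) (trans (len _) (sym (len _))) sub
    where
    sub : (σ G i · L (end₂ G i)) ⊆ L (end₁ G i)
    sub b∈ with a , a∈ , refl ← ∈-map⁻ (⟦ σ G i ⟧ ℤ.*_) b∈ =
      case (⟦ σ G i ⟧ ℤ.* a) ∈? L (end₁ G i) of λ where
        (yes p) → p
        (no ¬p) → ⊥-elim (<⇒≢ (all-positive (L (end₂ G i))
          (λ c → mult≤1 (⟦ σ G i ⟧ ℤ.* c) (uniq _)) (≤-trans (≤-reflexive (len _)) (≮⇒≥ ≮k)) a∈)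
          (sym (∉⇒mult≡0 (L (end₁ G i)) ¬p)))

  ↭⇒≈ : ∀ i → (σ G i · L (end₂ G i)) ↭ L (end₁ G i) → L (end₁ G i) ≈ (σ G i · L (end₂ G i))
  ↭⇒≈ i p a = PermP.∈-resp-↭ (Perm.↭-sym p) , PermP.∈-resp-↭ p

  -- Both claims rest on this: either alternative yields minimality, and equality of the counts
  -- excludes the first.
  dichotomy : 1 ≤ k → m + (m C 3) ≤ k →
    P G k < PL G L ⊎ (∀ i → (σ G i · L (end₂ G i)) ↭ L (end₁ G i))
  dichotomy 1≤k bound with FinP.any? (λ i → matched G i <? k)
  ... | yes (i , lt) = inj₁ (Comparison.PL-strict G L (λ _ → M k) uniq len (λ _ → M-unique k) (λ _ → M-length k)
                               (λ i → M-closed k (σ G i)) 1≤k bound i lt)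
  ... | no none      = inj₂ (λ i → matched≮⇒↭ i (λ lt → none (i , lt)))

-- The subtraction truncates only at `m` equal to 0, treated apart; otherwise the 1 it removes is
-- restored by the strict inequality.
bound-without-∸ : ∀ m {k} → 1 ≤ k → (m C 3) + (m C 4) + m ∸ 1 < k → m + (m C 3) ≤ k
bound-without-∸ zero    _ _ = z≤n
bound-without-∸ (suc m) {k} _ lt = begin
  suc m + (suc m C 3)                       ≤⟨ m≤m+n _ (suc m C 4) ⟩
  suc m + (suc m C 3) + (suc m C 4)         ≡⟨ lemma m (suc m C 3) (suc m C 4) ⟩
  suc ((suc m C 3) + (suc m C 4) + m)       ≡⟨ cong (λ z → suc (z ∸ 1)) (sym (+-suc ((suc m C 3) + (suc m C 4)) m)) ⟩
  suc ((suc m C 3) + (suc m C 4) + suc m ∸ 1)  ≤⟨ lt ⟩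
  k                                         ∎
  where
  open ≤-Reasoning
  lemma : ∀ m a b → suc m + a + b ≡ suc (a + b + m)
  lemma = solve-∀

theorem1p1 : ∀ {n m} (Σg : SignedGraph n m) (k : ℕ) →
    1 ≤ k → (m C 3) + (m C 4) + m ∸ 1 < k →
    IsPl Σg k (P Σg k)
    × (∀ (L : ListAssignment n) → IsKAssignment L k → PL Σg L ≡ P Σg k →
    (∀ (e : Fin m) → L (end₁ Σg e) ≈ (σ Σg e · L (end₂ Σg e)))
    × (Unbalanced Σg → ∀ (v : Fin n) → InUnbalancedComponent Σg v →
    L v ≈ (neg · L v)))
theorem1p1 {n} {m} G k 1≤k hk = (minimal , (λ _ → M k) , (λ _ → M-unique k , M-length k) , refl) , rigid
  where
  bound : m + (m C 3) ≤ k
  bound = bound-without-∸ m 1≤k hk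

  minimal : ∀ L → IsKAssignment L k → P G k ≤ PL G L
  minimal L isK with dichotomy G L (proj₁ ∘ isK) (proj₂ ∘ isK) 1≤k bound
  ... | inj₁ lt   = <⇒≤ lt
  ... | inj₂ cons = P≤PL G L (proj₁ ∘ isK) (proj₂ ∘ isK) cons

  rigid : ∀ L → IsKAssignment L k → PL G L ≡ P G k →
    (∀ e → L (end₁ G e) ≈ (σ G e · L (end₂ G e)))
    × (Unbalanced G → ∀ v → InUnbalancedComponent G v → L v ≈ (neg · L v))
  rigid L isK eq with dichotomy G L (proj₁ ∘ isK) (proj₂ ∘ isK) 1≤k bound
  ... | inj₁ lt   = ⊥-elim (<⇒≢ lt (sym eq))
  -- Self-negation holds at the cycle vertex `j` and is carried along `path` to `v`.
  ... | inj₂ perm = cons , λ { _ v (Z , odd , j , path) →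
    ~⇒≈ (connected-symmetric G L cons path (cycle-symmetric G L cons Z odd j)) }
    where
    cons : ∀ e → L (end₁ G e) ≈ (σ G e · L (end₂ G e))
    cons e = ↭⇒≈ G L (proj₁ ∘ isK) (proj₂ ∘ isK) e (perm e)
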